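{- Let $v\in\mathbb{N}$ and $n=2^a$ for some $a\in\mathbb{Z}^+$. Define rational polynomials $y_v(k)$ by $y_0(k)=-\tfrac12$ and, for $v\ge1$, $y_v(k)=-\tfrac12(2k+3)^{2v}+\sum_{j=1}^{v}e_j^{(2v)}y_{v-j}(k)$; and $\tilde y_v(k)$ by $\tilde y_0(k)=\tfrac14$ and, for $v\ge1$, $\tilde y_v(k)=\tfrac14(2k+3)^{2v}-\sum_{j=1}^{v}\tfrac{e_j^{(2v)}}{2}\tilde y_{v-j}(k)$. Put $$\rho_v=1-2\sum_{j=1}^{v}e_j^{(2v)}y_{v-j}(-1),\qquad \tilde\rho_v=2v-\sum_{j=1}^{v}e_j^{(2v)}\tilde y_{v-j}'(-1),$$ where $'$ denotes the derivative in $k$. Then $\rho_v$ is an odd integer, $\tilde\rho_v$ is an even integer (both independent of $n$), and $$\sum_{k=0}^{n-1}(2k+1)^{2v+1}D_k\equiv \rho_v n\pmod{n^3},\qquad \sum_{k=0}^{n-1}(-1)^k(2k+1)^{2v+1}D_k\equiv \tilde\rho_v n^2\pmod{n^3}.$$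
   Context: $D_n=\sum_{k=0}^{n}\binom{n}{k}\binom{n+k}{k}$ are the central Delannoy numbers. For $s\in\mathbb{N}$ and $1\le j\le\lfloor (s+1)/2\rfloor$, $e_j^{(s)}=\binom{s}{2j}2^{2j-1}+\binom{s}{2j-1}2^{2j-2}$ (these are even integers when $s$ is even). -}

module Defs where

open import Algebra.Bundles.Raw using (RawMonoid)
import Algebra.Definitions.RawMonoid as RawMonoidDefs
open import Data.Fin.Base using (Fin; zero; suc; toℕ)
open import Data.Integer.Base as ℤ using (ℤ; +_; 1ℤ)
open import Data.Integer.Divisibility using (_∣_)
open import Data.List.Base using (List; []; _∷_; foldr; map)
open import Data.Nat.Base as ℕ using (ℕ; zero; suc; _∸_)
open import Data.Nat.Combinatorics using (_C_)
open import Data.Product.Base using (∃-syntax)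
open import Data.Rational.Base as ℚ using (ℚ; 0ℚ; 1ℚ; ½; _/_)
open import Data.Vec.Base using (Vec; []; _∷_; lookup)
open import Function.Base using (_∘_)
open import Level using (0ℓ)
open import Relation.Binary.PropositionalEquality
  using (_≡_; refl; cong; cong₂)

-- ∑< n f = f 0 + … + f (n - 1)   and   ∑₁ n f = f 1 + … + f n
module Sums (M : RawMonoid 0ℓ 0ℓ) where
  open RawMonoid M using (Carrier)
  open RawMonoidDefs M public using (sum)

  ∑< : ℕ → (ℕ → Carrier) → Carrier
  ∑< n f = sum {n} (f ∘ toℕ)

  ∑₁ : ℕ → (ℕ → Carrier) → Carrier
  ∑₁ n f = ∑< n (f ∘ suc)

module ∑ℕ = Sums ℕ.+-0-rawMonoid
module ∑ℤ = Sums ℤ.+-0-rawMonoid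
module ∑ℚ = Sums ℚ.+-0-rawMonoid

infix 4 _≡_[mod_]

_≡_[mod_] : ℤ → ℤ → ℕ → Set
a ≡ b [mod m ] = + m ∣ a ℤ.- b

Even Odd : ℤ → Set
Even a = ∃[ b ] a ≡ + 2 ℤ.* b
Odd  a = ∃[ b ] a ≡ + 2 ℤ.* b ℤ.+ 1ℤ

D : ℕ → ℕ
D n = ∑ℕ.∑< (suc n) (λ k → (n C k) ℕ.* ((n ℕ.+ k) C k))

-- Only used for j ≥ 1, where the subtractions are exact.
e : ℕ → ℕ → ℕ
e j s = (s C (2 ℕ.* j)) ℕ.* 2 ℕ.^ (2 ℕ.* j ∸ 1)
  ℕ.+ (s C (2 ℕ.* j ∸ 1)) ℕ.* 2 ℕ.^ (2 ℕ.* j ∸ 2)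

-- a₀ ∷ a₁ ∷ … ∷ a_d ∷ [] is a₀ + a₁ X + … + a_d X^d. Trailing zeros are
-- allowed, so different lists may represent the same polynomial.
Poly : Set
Poly = List ℚ

infixl 6 _+ₚ_
infixl 7 _*ₚ_
infixr 8 _·ₚ_
infixr 9 _^ₚ_

_+ₚ_ : Poly → Poly → Poly
[]        +ₚ q       = q
p@(_ ∷ _) +ₚ []      = p
(a ∷ p)   +ₚ (b ∷ q) = (a ℚ.+ b) ∷ (p +ₚ q)

_·ₚ_ : ℚ → Poly → Poly
c ·ₚ p = map (c ℚ.*_) p

-ₚ_ : Poly → Poly
-ₚ p = map ℚ.-_ p

_*ₚ_ : Poly → Poly → Poly
[]      *ₚ q = []
(a ∷ p) *ₚ q = a ·ₚ q +ₚ (0ℚ ∷ p *ₚ q)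

_^ₚ_ : Poly → ℕ → Poly
p ^ₚ zero  = 1ℚ ∷ []
p ^ₚ suc n = p *ₚ p ^ₚ n

eval : Poly → ℚ → ℚ
eval p x = foldr (λ a r → a ℚ.+ x ℚ.* r) 0ℚ p

derivFrom : ℕ → Poly → Poly
derivFrom i []      = []
derivFrom i (a ∷ p) = (+ i / 1) ℚ.* a ∷ derivFrom (suc i) p

deriv : Poly → Poly
deriv []      = []
deriv (_ ∷ p) = derivFrom 1 p

+ₚ-rawMonoid : RawMonoid 0ℓ 0ℓ
+ₚ-rawMonoid = record { Carrier = Poly ; _≈_ = _≡_ ; _∙_ = _+ₚ_ ; ε = [] }

module ∑ₚ = Sums +ₚ-rawMonoid

-- Course-of-values recursion. The vector given to step v lists the earlier
-- values in the order f (v - 1), …, f 0, so that index j - 1 holds f (v - j).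
module CourseOfValues {A : Set} (step : ∀ v → Vec A v → A) where

  history : ∀ v → Vec A v
  history zero    = []
  history (suc v) = step v (history v) ∷ history v

  value : ℕ → A
  value v = step v (history v)

  lookup-history : ∀ v (i : Fin v) →
    lookup (history v) i ≡ value (v ∸ suc (toℕ i))
  lookup-history (suc v) zero    = refl
  lookup-history (suc v) (suc i) = lookup-history v i

2X+3 : Poly
2X+3 = (+ 3 / 1) ∷ (+ 2 / 1) ∷ []

y-step ỹ-step : ∀ v → Vec Poly v → Poly

y-step zero      _    = (ℚ.- ½) ∷ []
y-step v@(suc _) prev =
  (ℚ.- ½) ·ₚ 2X+3 ^ₚ (2 ℕ.* v)
    +ₚ ∑ₚ.sum (λ i → (+ e (suc (toℕ i)) (2 ℕ.* v) / 1) ·ₚ lookup prev i)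

ỹ-step zero      _    = (+ 1 / 4) ∷ []
ỹ-step v@(suc _) prev =
  (+ 1 / 4) ·ₚ 2X+3 ^ₚ (2 ℕ.* v)
    +ₚ -ₚ ∑ₚ.sum (λ i → (+ e (suc (toℕ i)) (2 ℕ.* v) / 2) ·ₚ lookup prev i)

y ỹ : ℕ → Poly
y = CourseOfValues.value y-step
ỹ = CourseOfValues.value ỹ-step

sum-cong : ∀ {n} {f g : Fin n → Poly} → (∀ i → f i ≡ g i) →
  ∑ₚ.sum f ≡ ∑ₚ.sum g
sum-cong {zero}  f≡g = refl
sum-cong {suc n} f≡g = cong₂ _+ₚ_ (f≡g zero) (sum-cong (f≡g ∘ suc))

sum-history : (step : ∀ v → Vec Poly v → Poly) (c : ℕ → ℚ) →
  let open CourseOfValues step in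
  ∀ v → ∑ₚ.sum (λ i → c (suc (toℕ i)) ·ₚ lookup (history v) i)
      ≡ ∑ₚ.∑₁ v (λ j → c j ·ₚ value (v ∸ j))
sum-history step c v = sum-cong λ i →
  cong (c (suc (toℕ i)) ·ₚ_) (CourseOfValues.lookup-history step v i)

-- The defining recurrences.
y-zero : y 0 ≡ (ℚ.- ½) ∷ []
y-zero = refl

y-suc : ∀ u → let v = suc u in
  y v ≡ (ℚ.- ½) ·ₚ 2X+3 ^ₚ (2 ℕ.* v)
    +ₚ ∑ₚ.∑₁ v (λ j → (+ e j (2 ℕ.* v) / 1) ·ₚ y (v ∸ j))
y-suc u = let v = suc u in
  cong ((ℚ.- ½) ·ₚ 2X+3 ^ₚ (2 ℕ.* v) +ₚ_)
    (sum-history y-step (λ j → + e j (2 ℕ.* v) / 1) v)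

ỹ-zero : ỹ 0 ≡ (+ 1 / 4) ∷ []
ỹ-zero = refl

ỹ-suc : ∀ u → let v = suc u in
  ỹ v ≡ (+ 1 / 4) ·ₚ 2X+3 ^ₚ (2 ℕ.* v)
    +ₚ -ₚ ∑ₚ.∑₁ v (λ j → (+ e j (2 ℕ.* v) / 2) ·ₚ ỹ (v ∸ j))
ỹ-suc u = let v = suc u in
  cong (λ p → (+ 1 / 4) ·ₚ 2X+3 ^ₚ (2 ℕ.* v) +ₚ -ₚ p)
    (sum-history ỹ-step (λ j → + e j (2 ℕ.* v) / 2) v)

ρ ρ̃ : ℕ → ℚ
ρ v = 1ℚ ℚ.- (+ 2 / 1) ℚ.*
  ∑ℚ.∑₁ v (λ j → (+ e j (2 ℕ.* v) / 1) ℚ.* eval (y (v ∸ j)) (ℚ.- 1ℚ))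
ρ̃ v = (+ (2 ℕ.* v) / 1) ℚ.-
  ∑ℚ.∑₁ v (λ j → (+ e j (2 ℕ.* v) / 1) ℚ.* eval (deriv (ỹ (v ∸ j))) (ℚ.- 1ℚ))

{-# OPTIONS --safe #-}
module Submission where

-- The recursions for y and ỹ express that the adjoint of the three-term
-- recurrence of D k, respectively (-1)ᵏ D k, maps them to (2k + 1)²ᵛ⁺¹. Hence
-- both sums telescope to n (X (n - 1) F ((2n + 1)²) - X n F ((2n - 1)²)) up to a
-- constant, with F an integral polynomial, and a Taylor expansion of F at 1 leaves
-- only D n ∓ D (n - 1) to be determined. With U = (1 + x) / (1 - x) one has
--   D n = [xⁿ] Uⁿ / (1 - x),  D (n - 1) = [xⁿ] Uⁿ - [xⁿ] Uⁿ / (1 + x),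
--   D n + D (n - 1) = 2 [xⁿ] Uⁿ.
-- Since x ↦ - x inverts U, for even n these reduce to Uⁿ + U⁻ⁿ, and
-- Uⁿ + U⁻ⁿ = 2 + (Uⁿᐟ² - U⁻ⁿᐟ²)² ≡ 2 (mod 4n²) when n is a power of 2. So
-- D n - D (n - 1) ≡ 2 (mod 2n²) and D n + D (n - 1) ≡ 0 (mod 4n²).

-- Both recursions are solved over the integers. Put F_v(x) = x^v + Σ w_j F_(v-j)(x). For w_j = e_j
-- one has y_v(k) = -½ F_v((2k + 3)²); for w_j = -e_j / 2 one has ỹ_v(k) = ¼ F_v((2k + 3)²). At k =
-- -1 the argument is 1, so ρ_v is F_v(1) for the first weights and ρ̃_v is 2 F_v'(1) for the
-- second. Evenness of e_j makes the second weights integral and F_v(1) odd for the first.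
--
-- The two sums are instances of one computation: the recurrence has middle coefficient σ (2n + 3)
-- with σ = 3 or σ = -3, and the telescoped identity determines 1 - σ = -2 or 4 times the sum. This
-- factor has to be cancelled, so congruences modulo powers of n alone would lose powers of 2. The
-- spare ones come from (2n ± 1)² - 1 = 4n (n ± 1) and from the moduli 2n² and 4n². The sign (-1)ᵏ
-- exchanges D n - D (n - 1) with D n + D (n - 1): hence the value F(1) survives in the plain sum,
-- and the derivative F'(1) in the alternating one.

open import Defs

-- Finite sums of integers.

module IntegerSums where
  open import Data.Integer.Base using (ℤ; +_; _+_; _*_; 0ℤ)
  open import Data.Integer.Properties
  open import Data.Integer.Tactic.RingSolver using (solve-∀)
  open import Data.Nat.Base as ℕ using (ℕ; zero; suc; z<s; s<s)
  open import Function.Base using (_∘_)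
  open import Relation.Binary.PropositionalEquality
  open ∑ℤ using (∑<)

  ∑<-cong : ∀ n {f g : ℕ → ℤ} → (∀ k → k ℕ.< n → f k ≡ g k) → ∑< n f ≡ ∑< n g
  ∑<-cong zero    eq = refl
  ∑<-cong (suc n) eq = cong₂ _+_ (eq 0 z<s) (∑<-cong n (λ k k<n → eq (suc k) (s<s k<n)))

  ∑<-+ : ∀ n f g → ∑< n (λ k → f k + g k) ≡ ∑< n f + ∑< n g
  ∑<-+ zero    f g = refl
  ∑<-+ (suc n) f g =
    trans (cong (_+_ (f 0 + g 0)) (∑<-+ n (f ∘ suc) (g ∘ suc))) (lemma (f 0) (g 0) _ _)
    where
    lemma : ∀ a b x y → (a + b) + (x + y) ≡ (a + x) + (b + y)
    lemma = solve-∀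

  ∑<-*ˡ : ∀ n c f → ∑< n (λ k → c * f k) ≡ c * ∑< n f
  ∑<-*ˡ zero    c f = sym (*-zeroʳ c)
  ∑<-*ˡ (suc n) c f =
    trans (cong (_+_ (c * f 0)) (∑<-*ˡ n c (f ∘ suc))) (sym (*-distribˡ-+ c (f 0) _))

  ∑<-last : ∀ n f → ∑< (suc n) f ≡ ∑< n f + f n
  ∑<-last zero    f = +-comm (f 0) 0ℤ
  ∑<-last (suc n) f =
    trans (cong (_+_ (f 0)) (∑<-last n (f ∘ suc))) (sym (+-assoc (f 0) _ _))

  pos-∑< : ∀ n (f : ℕ → ℕ) → + ∑ℕ.∑< n f ≡ ∑< n (+_ ∘ f)
  pos-∑< zero    f = refl
  pos-∑< (suc n) f = trans (pos-+ (f 0) _) (cong (_+_ (+ f 0)) (pos-∑< n (f ∘ suc)))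

-- Formal power series over the integers as a commutative ring.

module IntegerSeries where
  open import Algebra.Bundles using (CommutativeRing)
  import Algebra.Consequences.Setoid as Consequences
  open import Data.Integer.Base using (ℤ; +_; -_; _+_; _*_; 0ℤ; 1ℤ)
  open import Data.Integer.Properties
  open import Data.Integer.Tactic.RingSolver using (solve-∀)
  open import Data.Nat.Base as ℕ using (ℕ; zero; suc; _∸_)
  open import Data.Product.Base using (_,_)
  open import Function.Base using (_∘_)
  open import Level using (0ℓ)
  open import Relation.Binary.Bundles using (Setoid)
  open import Relation.Binary.PropositionalEquality
  open ∑ℤ using (∑<)

  Series : Set
  Series = ℕ → ℤ

  infixl 7 _⊛_

  -- The Cauchy product, defined through f = f 0 + x (f ∘ suc). With this recursion the ring laws
  -- are inductions on the index of the coefficient and need no reindexing of double sums; the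
  -- closed form is recovered in `⊛-coefficient`.
  _⊛_ : Series → Series → Series
  (f ⊛ g) zero    = f 0 * g 0
  (f ⊛ g) (suc n) = f 0 * g (suc n) + (f ∘ suc ⊛ g) n

  const : ℤ → Series
  const c zero    = c
  const c (suc _) = 0ℤ

  0ˢ 1ˢ : Series
  0ˢ _ = 0ℤ
  1ˢ   = const 1ℤ

  ⊛-cong : ∀ {f f′ g g′} → f ≗ f′ → g ≗ g′ → f ⊛ g ≗ f′ ⊛ g′
  ⊛-cong p q zero    = cong₂ _*_ (p 0) (q 0)
  ⊛-cong p q (suc n) =
    cong₂ _+_ (cong₂ _*_ (p 0) (q (suc n))) (⊛-cong (p ∘ suc) q n)

  ⊛-distribʳ : ∀ h f g → (λ k → f k + g k) ⊛ h ≗ λ k → (f ⊛ h) k + (g ⊛ h) k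
  ⊛-distribʳ h f g zero    = *-distribʳ-+ (h 0) (f 0) (g 0)
  ⊛-distribʳ h f g (suc n) =
    trans (cong (_+_ ((f 0 + g 0) * h (suc n))) (⊛-distribʳ h (f ∘ suc) (g ∘ suc) n))
      (lemma (f 0) (g 0) (h (suc n)) _ _)
    where
    lemma : ∀ a b c x y → (a + b) * c + (x + y) ≡ (a * c + x) + (b * c + y)
    lemma = solve-∀

  ⊛-scaleˡ : ∀ c f g → (λ k → c * f k) ⊛ g ≗ λ k → c * (f ⊛ g) k
  ⊛-scaleˡ c f g zero    = *-assoc c (f 0) (g 0)
  ⊛-scaleˡ c f g (suc n) =
    trans (cong (_+_ (c * f 0 * g (suc n))) (⊛-scaleˡ c (f ∘ suc) g n))
      (lemma c (f 0) (g (suc n)) _)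
    where
    lemma : ∀ c a b x → c * a * b + c * x ≡ c * (a * b + x)
    lemma = solve-∀

  0ˢ-⊛ : ∀ g → 0ˢ ⊛ g ≗ 0ˢ
  0ˢ-⊛ g zero    = refl
  0ˢ-⊛ g (suc n) = trans (+-identityˡ _) (0ˢ-⊛ g n)

  const-⊛ : ∀ c g → const c ⊛ g ≗ λ k → c * g k
  const-⊛ c g zero    = refl
  const-⊛ c g (suc n) =
    trans (cong (_+_ (c * g (suc n))) (0ˢ-⊛ g n)) (+-identityʳ _)

  -- The mirror image of the defining equation: the constant term of the right factor is split off.
  -- Commutativity is the induction that matches the two.
  ⊛-sucʳ : ∀ f g n → (f ⊛ g) (suc n) ≡ f (suc n) * g 0 + (f ⊛ g ∘ suc) n
  ⊛-sucʳ f g zero    = +-comm (f 0 * g 1) (f 1 * g 0)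
  ⊛-sucʳ f g (suc n) =
    trans (cong (_+_ (f 0 * g (suc (suc n)))) (⊛-sucʳ (f ∘ suc) g n))
      (lemma (f 0 * g (suc (suc n))) (f (suc (suc n)) * g 0) _)
    where
    lemma : ∀ a b c → a + (b + c) ≡ b + (a + c)
    lemma = solve-∀

  ⊛-comm : ∀ f g → f ⊛ g ≗ g ⊛ f
  ⊛-comm f g zero    = *-comm (f 0) (g 0)
  ⊛-comm f g (suc n) =
    trans (cong₂ _+_ (*-comm (f 0) (g (suc n))) (⊛-comm (f ∘ suc) g n))
      (sym (⊛-sucʳ g f n))

  ⊛-assoc : ∀ f g h → (f ⊛ g) ⊛ h ≗ f ⊛ (g ⊛ h)
  ⊛-assoc f g h zero    = *-assoc (f 0) (g 0) (h 0)
  ⊛-assoc f g h (suc n) = begin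
    f 0 * g 0 * h (suc n) + ((λ k → f 0 * g (suc k) + (f ∘ suc ⊛ g) k) ⊛ h) n
      ≡⟨ cong (_+_ (f 0 * g 0 * h (suc n)))
           (trans (⊛-distribʳ h (λ k → f 0 * g (suc k)) (f ∘ suc ⊛ g) n)
             (cong₂ _+_ (⊛-scaleˡ (f 0) (g ∘ suc) h n) (⊛-assoc (f ∘ suc) g h n))) ⟩
    f 0 * g 0 * h (suc n) + (f 0 * (g ∘ suc ⊛ h) n + (f ∘ suc ⊛ (g ⊛ h)) n)
      ≡⟨ lemma (f 0) (g 0) (h (suc n)) _ _ ⟩
    f 0 * (g 0 * h (suc n) + (g ∘ suc ⊛ h) n) + (f ∘ suc ⊛ (g ⊛ h)) n ∎
    where
    open ≡-Reasoning
    lemma : ∀ a b c x y → a * b * c + (a * x + y) ≡ a * (b * c + x) + y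
    lemma = solve-∀

  ⊛-coefficient : ∀ f g n → (f ⊛ g) n ≡ ∑< (suc n) (λ k → f k * g (n ∸ k))
  ⊛-coefficient f g zero    = sym (+-identityʳ _)
  ⊛-coefficient f g (suc n) = cong (_+_ (f 0 * g (suc n))) (⊛-coefficient (f ∘ suc) g n)

  seriesSetoid : Setoid 0ℓ 0ℓ
  seriesSetoid = ℕ →-setoid ℤ

  -- Equality is pointwise, so no function extensionality is involved; the price is explicit
  -- congruence steps wherever series are rewritten.
  seriesRing : CommutativeRing 0ℓ 0ℓ
  seriesRing = record
    { Carrier = Series
    ; _≈_ = _≗_
    ; _+_ = λ f g k → f k + g k
    ; _*_ = _⊛_
    ; -_ = λ f k → - f k
    ; 0# = 0ˢ
    ; 1# = 1ˢ
    ; isCommutativeRing = record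
      { isRing = record
        { +-isAbelianGroup = record
          { isGroup = record
            { isMonoid = record
              { isSemigroup = record
                { isMagma = record
                  { isEquivalence = Setoid.isEquivalence seriesSetoid
                  ; ∙-cong = λ p q k → cong₂ _+_ (p k) (q k)
                  }
                ; assoc = λ f g h k → +-assoc (f k) (g k) (h k)
                }
              ; identity = (λ f k → +-identityˡ (f k)) , (λ f k → +-identityʳ (f k))
              }
            ; inverse = (λ f k → +-inverseˡ (f k)) , (λ f k → +-inverseʳ (f k))
            ; ⁻¹-cong = λ p k → cong -_ (p k)
            }
          ; comm = λ f g k → +-comm (f k) (g k)
          }
        ; *-cong = ⊛-cong
        ; *-assoc = ⊛-assoc
        ; *-identity = comm∧idˡ⇒id ⊛-comm
            (λ f k → trans (const-⊛ 1ℤ f k) (*-identityˡ (f k)))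
        ; distrib = comm∧distrʳ⇒distr (λ p q k → cong₂ _+_ (p k) (q k)) ⊛-comm ⊛-distribʳ
        }
      ; *-comm = ⊛-comm
      }
    }
    where open Consequences seriesSetoid

-- Sums and differences of powers of two inverse elements under doubling of the exponent.

module Doubling where
  open import Algebra.Bundles using (CommutativeSemiring)
  open import Data.Nat.Base as ℕ using (ℕ; zero; suc)
  open import Data.Product.Base using (∃₂; _×_; _,_)

  module _ {c ℓ} (R : CommutativeSemiring c ℓ) where
    open CommutativeSemiring R
    open import Algebra.Properties.CommutativeSemiring.Exp R
    open import Algebra.Solver.Ring.NaturalCoefficients.Default R
    open import Relation.Binary.Reasoning.Setoid setoid

    -- This is u² + w² = 2uw + (u - w)², with the subtraction replaced by the presentation of u as w
    -- plus a multiple of 2d.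
    double-sum : ∀ {u w} d q → u ≈ w + (d + d) * q → u * w ≈ 1# →
      u * u + w * w ≈ (1# + 1#) + ((d + d) * q) * ((d + d) * q)
    double-sum {u} {w} d q u≈ uw≈1 = begin
      u * u + w * w
        ≈⟨ +-congʳ (*-cong u≈ u≈) ⟩
      (w + (d + d) * q) * (w + (d + d) * q) + w * w
        ≈⟨ solve 2 (λ w c → (w :+ c) :* (w :+ c) :+ w :* w
             := ((w :+ c) :* w :+ (w :+ c) :* w) :+ c :* c) refl w ((d + d) * q) ⟩
      ((w + (d + d) * q) * w + (w + (d + d) * q) * w) + ((d + d) * q) * ((d + d) * q)
        ≈⟨ +-congʳ (+-cong ≈1 ≈1) ⟩
      (1# + 1#) + ((d + d) * q) * ((d + d) * q) ∎
      where
      ≈1 : (w + (d + d) * q) * w ≈ 1#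
      ≈1 = trans (*-congʳ (sym u≈)) uw≈1

    -- This is u² - w² = (u - w)(u + w): one factor supplies 2d and the even factor u + w supplies
    -- the additional 2.
    double-difference : ∀ {u w} d q p → u ≈ w + (d + d) * q → u + w ≈ p + p →
      u * u ≈ w * w + ((d + d) + (d + d)) * (q * p)
    double-difference {u} {w} d q p u≈ u+w≈ = begin
      u * u
        ≈⟨ *-cong u≈ u≈ ⟩
      (w + (d + d) * q) * (w + (d + d) * q)
        ≈⟨ solve 2 (λ w c → (w :+ c) :* (w :+ c)
             := w :* w :+ c :* ((w :+ c) :+ w)) refl w ((d + d) * q) ⟩
      w * w + ((d + d) * q) * ((w + (d + d) * q) + w)
        ≈⟨ +-congˡ (*-congˡ (trans (+-congʳ (sym u≈)) u+w≈)) ⟩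
      w * w + ((d + d) * q) * (p + p)
        ≈⟨ solve 4 (λ w d q p → w :* w :+ ((d :+ d) :* q) :* (p :+ p)
             := w :* w :+ ((d :+ d) :+ (d :+ d)) :* (q :* p)) refl w d q p ⟩
      w * w + ((d + d) + (d + d)) * (q * p) ∎

    ^-double : ∀ v m → v ^ (2 ℕ.* m) ≈ v ^ m * v ^ m
    ^-double v m = trans (^-homo-* v m (m ℕ.+ 0))
      (*-congˡ (trans (^-homo-* v m 0) (*-identityʳ _)))

    ^-inverse : ∀ {u w} → u * w ≈ 1# → ∀ n → u ^ n * w ^ n ≈ 1#
    ^-inverse {u} {w} uw≈1 n =
      trans (sym (^-distrib-* u w n)) (trans (^-congˡ n uw≈1) (1^ n))
      where
      1^ : ∀ n → 1# ^ n ≈ 1#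
      1^ zero    = refl
      1^ (suc n) = trans (*-identityˡ _) (1^ n)

    -- Meant for a = 1 + x, g = 1 / (1 - x) and h = 1 / (1 + x): it brings a and h together so that
    -- they cancel.
    reorder : ∀ a g u h → ((a * g) * u) * h ≈ (u * g) * (a * h)
    reorder = solve 4 (λ a g u h → ((a :* g) :* u) :* h := (u :* g) :* (a :* h)) refl

    -- The difference u ^ m - w ^ m doubles its content together with m, because
    -- the other factor u ^ m + w ^ m of the next difference is even.
    power-difference : ∀ u w (d : ℕ → Carrier) →
      u * w ≈ 1# → (∀ a → d (suc a) ≈ d a + d a) →
      (∃₂ λ q p → u ≈ w + (d 0 + d 0) * q × u + w ≈ p + p) →
      ∀ a → let m = 2 ℕ.^ a in
      ∃₂ λ q p → u ^ m ≈ w ^ m + (d a + d a) * q × u ^ m + w ^ m ≈ p + p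
    power-difference u w d uw≈1 d-suc (q , p , u≈ , u+w≈) zero =
      q , p ,
      trans (*-identityʳ u) (trans u≈ (+-congʳ (sym (*-identityʳ w)))) ,
      trans (+-cong (*-identityʳ u) (*-identityʳ w)) u+w≈
    power-difference u w d uw≈1 d-suc base (suc a)
      with q , p , diff , sum ← power-difference u w d uw≈1 d-suc base a =
      q * p , 1# + d a * (d a + d a) * (q * q) ,
      (begin
        u ^ (2 ℕ.* m)         ≈⟨ ^-double u m ⟩
        u ^ m * u ^ m         ≈⟨ double-difference (d a) q p diff sum ⟩
        w ^ m * w ^ m + ((d a + d a) + (d a + d a)) * (q * p)
          ≈⟨ +-cong (^-double w m) (*-congʳ (+-cong (d-suc a) (d-suc a))) ⟨
        w ^ (2 ℕ.* m) + (d (suc a) + d (suc a)) * (q * p) ∎) ,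
      (begin
        u ^ (2 ℕ.* m) + w ^ (2 ℕ.* m)     ≈⟨ +-cong (^-double u m) (^-double w m) ⟩
        u ^ m * u ^ m + w ^ m * w ^ m
          ≈⟨ double-sum (d a) q diff (^-inverse uw≈1 m) ⟩
        (1# + 1#) + ((d a + d a) * q) * ((d a + d a) * q)
          ≈⟨ solve 2 (λ d q → (con 1 :+ con 1) :+ ((d :+ d) :* q) :* ((d :+ d) :* q)
               := (con 1 :+ d :* (d :+ d) :* (q :* q))
                  :+ (con 1 :+ d :* (d :+ d) :* (q :* q))) refl (d a) q ⟩
        (1# + d a * (d a + d a) * (q * q)) + (1# + d a * (d a + d a) * (q * q)) ∎)
      where m = 2 ℕ.^ a

    -- Multiplying u by (1 + x) h ≈ 1 and w by m g ≈ 1 makes g h a common factor.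
    module _ {x m g h} (m+x≈1 : m + x ≈ 1#) (mg≈1 : m * g ≈ 1#) (ah≈1 : (1# + x) * h ≈ 1#) where
      private
        u w : Carrier
        u = (1# + x) * g
        w = m * h

        u-common : u ≈ ((m + x) + x) * ((m + x) + x) * (g * h)
        u-common = begin
          u                                         ≈⟨ *-identityʳ u ⟨
          u * 1#                                    ≈⟨ *-congˡ ah≈1 ⟨
          u * ((1# + x) * h)
            ≈⟨ *-cong (*-congʳ (+-congʳ m+x≈1)) (*-congʳ (+-congʳ m+x≈1)) ⟨
          (((m + x) + x) * g) * (((m + x) + x) * h)
            ≈⟨ solve 3 (λ a g h → (a :* g) :* (a :* h) := a :* a :* (g :* h)) refl
                 ((m + x) + x) g h ⟩
          ((m + x) + x) * ((m + x) + x) * (g * h)   ∎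

        w-common : w ≈ m * m * (g * h)
        w-common = begin
          w                  ≈⟨ *-identityʳ w ⟨
          w * 1#             ≈⟨ *-congˡ mg≈1 ⟨
          w * (m * g)
            ≈⟨ solve 3 (λ m g h → (m :* h) :* (m :* g) := m :* m :* (g :* h)) refl m g h ⟩
          m * m * (g * h)    ∎

      cayley-inverse : u * w ≈ 1#
      cayley-inverse = begin
        u * w
          ≈⟨ solve 4 (λ a g m h → (a :* g) :* (m :* h) := (a :* h) :* (m :* g)) refl
               (1# + x) g m h ⟩
        ((1# + x) * h) * (m * g)    ≈⟨ *-cong ah≈1 mg≈1 ⟩
        1# * 1#                     ≈⟨ *-identityˡ 1# ⟩
        1#                          ∎

      -- Here m stands for 1 - x. Writing 1 as m + x turns both elements into quadratic forms in m
      -- and x times g h, and (m + 2x)² - m² = 4 (m + x) x, where m + x is 1 again. The factor 4 is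
      -- the start of the doubling induction.
      cayley-difference : u ≈ w + ((1# + 1#) + (1# + 1#)) * (x * (g * h))
      cayley-difference = begin
        u                                                   ≈⟨ u-common ⟩
        ((m + x) + x) * ((m + x) + x) * (g * h)
          ≈⟨ solve 3 (λ m x c → ((m :+ x) :+ x) :* ((m :+ x) :+ x) :* c
               := m :* m :* c :+ con 4 :* ((m :+ x) :* x :* c)) refl m x (g * h) ⟩
        m * m * (g * h) + ((1# + 1# + 1#) + 1#) * ((m + x) * x * (g * h))
          ≈⟨ +-cong (sym w-common)
               (*-cong (solve 0 (con 4 := (con 1 :+ con 1) :+ (con 1 :+ con 1)) refl)
                 (trans (*-assoc _ _ _) (trans (*-congʳ m+x≈1) (*-identityˡ _)))) ⟩
        w + ((1# + 1#) + (1# + 1#)) * (x * (g * h)) ∎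

      cayley-sum : let p = (m * m + m * x + m * x + x * x + x * x) * (g * h) in u + w ≈ p + p
      cayley-sum = trans (+-cong u-common w-common)
        (solve 3 (λ m x c →
          ((m :+ x) :+ x) :* ((m :+ x) :+ x) :* c :+ m :* m :* c
          := (m :* m :+ m :* x :+ m :* x :+ x :* x :+ x :* x) :* c
             :+ (m :* m :+ m :* x :+ m :* x :+ x :* x :+ x :* x) :* c) refl m x (g * h))

-- The summands of the Delannoy numbers and the three-term recurrence.

module Delannoy where
  open import Data.Integer.Base as ℤ using (ℤ; +_; _+_; _*_; _-_; 0ℤ; 1ℤ)
  open import Data.Integer.Properties
  open import Data.Integer.Tactic.RingSolver using (solve-∀)
  open import Data.Nat.Base as ℕ using (ℕ; zero; suc; _!)
  open import Data.Nat.Combinatorics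
    using (_C_; nCk+nC[k+1]≡[n+1]C[k+1]; nCn≡1; nCk≡nC[n∸k]; k>n⇒nCk≡0)
  import Data.Nat.Properties as ℕ
  open import Function.Base using (_∘_)
  open import Relation.Binary.PropositionalEquality
  open ≡-Reasoning
  open IntegerSums
  open ∑ℤ using (∑<)

  falling : ℤ → ℕ → ℤ
  falling x zero    = 1ℤ
  falling x (suc k) = falling x k * (x - + k)

  falling-suc : ∀ x k → falling (1ℤ + x) (suc k) ≡ (1ℤ + x) * falling x k
  falling-suc x zero    = lemma x
    where
    lemma : ∀ x → 1ℤ * (1ℤ + x - 0ℤ) ≡ (1ℤ + x) * 1ℤ
    lemma = solve-∀
  falling-suc x (suc k) =
    trans (cong (_* (1ℤ + x - + suc k)) (falling-suc x k)) (lemma x (falling x k) (+ k))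
    where
    lemma : ∀ x f k → (1ℤ + x) * f * (1ℤ + x - (1ℤ + k)) ≡ (1ℤ + x) * (f * (x - k))
    lemma = solve-∀

  nC0≡1 : ∀ n → n C 0 ≡ 1
  nC0≡1 n = trans (nCk≡nC[n∸k] {0} {n} ℕ.z≤n) (nCn≡1 n)

  +[1+k]! : ∀ k → + (suc k !) ≡ (1ℤ + + k) * + (k !)
  +[1+k]! k = pos-* (suc k) (k !)

  -- True for k > n as well, since the falling factorial then contains the factor 0. Pascal's rule
  -- becomes (1 + k) f + f (n - k) = (1 + n) f for f = `falling (+ n) k`.
  C*!≡falling : ∀ n k → + (n C k) * + (k !) ≡ falling (+ n) k
  C*!≡falling n       zero    = cong (λ c → + c * 1ℤ) (nC0≡1 n)
  C*!≡falling zero    (suc k) = sym (vanishes k)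
    where
    vanishes : ∀ k → falling 0ℤ (suc k) ≡ 0ℤ
    vanishes zero    = refl
    vanishes (suc k) = cong (_* (0ℤ - + suc k)) (vanishes k)
  C*!≡falling (suc n) (suc k) = begin
    + (suc n C suc k) * + (suc k !)
      ≡⟨ cong (λ c → + c * + (suc k !)) (nCk+nC[k+1]≡[n+1]C[k+1] n k) ⟨
    + (n C k ℕ.+ n C suc k) * + (suc k !)
      ≡⟨ cong (_* + (suc k !)) (pos-+ (n C k) (n C suc k)) ⟩
    (+ (n C k) + + (n C suc k)) * + (suc k !)
      ≡⟨ *-distribʳ-+ (+ (suc k !)) (+ (n C k)) (+ (n C suc k)) ⟩
    + (n C k) * + (suc k !) + + (n C suc k) * + (suc k !)
      ≡⟨ cong₂ _+_ (cong (+ (n C k) *_) (+[1+k]! k)) (C*!≡falling n (suc k)) ⟩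
    + (n C k) * ((1ℤ + + k) * + (k !)) + falling (+ n) k * (+ n - + k)
      ≡⟨ reorder (+ (n C k)) (+ k) (+ (k !)) _ ⟩
    (1ℤ + + k) * (+ (n C k) * + (k !)) + falling (+ n) k * (+ n - + k)
      ≡⟨ cong (λ f → (1ℤ + + k) * f + falling (+ n) k * (+ n - + k)) (C*!≡falling n k) ⟩
    (1ℤ + + k) * falling (+ n) k + falling (+ n) k * (+ n - + k)
      ≡⟨ collect (falling (+ n) k) (+ n) (+ k) ⟩
    (1ℤ + + n) * falling (+ n) k
      ≡⟨ falling-suc (+ n) k ⟨
    falling (+ suc n) (suc k) ∎
    where
    reorder : ∀ c k f r → c * ((1ℤ + k) * f) + r ≡ (1ℤ + k) * (c * f) + r
    reorder = solve-∀
    collect : ∀ f n k → (1ℤ + k) * f + f * (n - k) ≡ (1ℤ + n) * f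
    collect = solve-∀

  term : ℕ → ℕ → ℤ
  term n k = + ((n C k) ℕ.* ((n ℕ.+ k) C k))

  -- Scaling by k!² makes both binomial coefficients polynomial in n, which avoids
  -- distinguishing k ≤ n from k > n.
  scaledTerm : ℕ → ℕ → ℤ
  scaledTerm n k = falling (+ n) k * falling (+ n + + k) k

  C*C*!² : ∀ m n k → + (m C k) * + (n C k) * (+ (k !) * + (k !))
    ≡ falling (+ m) k * falling (+ n) k
  C*C*!² m n k = trans (reorder (+ (m C k)) (+ (n C k)) (+ (k !)))
    (cong₂ _*_ (C*!≡falling m k) (C*!≡falling n k))
    where
    reorder : ∀ a b f → a * b * (f * f) ≡ (a * f) * (b * f)
    reorder = solve-∀

  term*!² : ∀ n k → term n k * (+ (k !) * + (k !)) ≡ scaledTerm n k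
  term*!² n k = trans (cong (_* (+ (k !) * + (k !))) (pos-* (n C k) ((n ℕ.+ k) C k)))
    (C*C*!² n (n ℕ.+ k) k)

  cancel-!² : ∀ k {a b} → a * (+ (k !) * + (k !)) ≡ b * (+ (k !) * + (k !)) → a ≡ b
  cancel-!² k {a} {b} eq = *-cancelʳ-≡ a b (+ (k !))
    (*-cancelʳ-≡ _ _ (+ (k !)) (trans (*-assoc a _ _) (trans eq (sym (*-assoc b _ _)))))
    where
    instance
      k!≢0 : ℤ.NonZero (+ (k !))
      k!≢0 = k ℕ.!≢0

  -- For k ≤ n the scaled term is (n + k)! / (n - k)!, so an increment of k brings in one factor at
  -- either end. The recursions below are read off from this quotient.
  scaledTerm-sucʳ : ∀ n k → scaledTerm n (suc k)
    ≡ (+ n - + k) * (1ℤ + + n + + k) * scaledTerm n k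
  scaledTerm-sucʳ n k = trans
    (cong (λ x → falling (+ n) k * (+ n - + k) * falling x (suc k)) (shift (+ n) (+ k)))
    (trans (cong (falling (+ n) k * (+ n - + k) *_) (falling-suc (+ n + + k) k))
      (reorder (falling (+ n) k) (+ n) (+ k) _))
    where
    shift : ∀ n k → n + (1ℤ + k) ≡ 1ℤ + (n + k)
    shift = solve-∀
    reorder : ∀ f n k h →
      f * (n - k) * ((1ℤ + (n + k)) * h) ≡ (n - k) * (1ℤ + n + k) * (f * h)
    reorder = solve-∀

  falling-product : ∀ n k → falling (+ suc n) (suc k) * falling (1ℤ + (+ n + + k)) (suc k)
    ≡ (1ℤ + + n) * (1ℤ + + n + + k) * scaledTerm n k
  falling-product n k =
    trans (cong₂ _*_ (falling-suc (+ n) k) (falling-suc (+ n + + k) k))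
      (reorder (+ n) (+ k) (falling (+ n) k) _)
    where
    reorder : ∀ n k f h →
      ((1ℤ + n) * f) * ((1ℤ + (n + k)) * h) ≡ (1ℤ + n) * (1ℤ + n + k) * (f * h)
    reorder = solve-∀

  -- Incrementing n and k together keeps n - k, so only the numerator (n + k)! of the quotient gains
  -- factors.
  scaledTerm-suc² : ∀ n k → scaledTerm (suc n) (suc k)
    ≡ (1ℤ + + n + + k) * (+ 2 + + n + + k) * scaledTerm n k
  scaledTerm-suc² n k = *-cancelˡ-≡ (+ suc n) _ _ (begin
    (1ℤ + N) * (F * falling (1ℤ + N + (1ℤ + K)) (suc k))
      ≡⟨ cong (λ x → (1ℤ + N) * (F * falling x (suc k))) (shift N K) ⟩
    (1ℤ + N) * (F * falling (1ℤ + (1ℤ + (N + K))) (suc k))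
      ≡⟨ cong (λ x → (1ℤ + N) * (F * x)) (falling-suc (1ℤ + (N + K)) k) ⟩
    (1ℤ + N) * (F * ((1ℤ + (1ℤ + (N + K))) * falling (1ℤ + (N + K)) k))
      -- The auxiliary factor 1 + n equals (1 + (n + k)) - k, the last factor missing from
      -- `falling (1ℤ + (N + K)) (suc k)`; this is why the equation was multiplied by it.
      ≡⟨ reorder N K F _ ⟩
    (+ 2 + N + K) * (F * (falling (1ℤ + (N + K)) k * (1ℤ + (N + K) - K)))
      ≡⟨ cong ((+ 2 + N + K) *_) (falling-product n k) ⟩
    (+ 2 + N + K) * ((1ℤ + N) * (1ℤ + N + K) * scaledTerm n k)
      ≡⟨ collect N K (scaledTerm n k) ⟩
    (1ℤ + N) * ((1ℤ + N + K) * (+ 2 + N + K) * scaledTerm n k) ∎)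
    where
    N = + n
    K = + k
    F = falling (+ suc n) (suc k)
    shift : ∀ n k → 1ℤ + n + (1ℤ + k) ≡ 1ℤ + (1ℤ + (n + k))
    shift = solve-∀
    reorder : ∀ n k f h → (1ℤ + n) * (f * ((1ℤ + (1ℤ + (n + k))) * h))
      ≡ (+ 2 + n + k) * (f * (h * (1ℤ + (n + k) - k)))
    reorder = solve-∀
    collect : ∀ n k s → (+ 2 + n + k) * ((1ℤ + n) * (1ℤ + n + k) * s)
      ≡ (1ℤ + n) * ((1ℤ + n + k) * (+ 2 + n + k) * s)
    collect = solve-∀

  -- Compare the two preceding expressions for `scaledTerm (suc n) (suc k)`. The factor 1 + n - k
  -- stays on the left because it vanishes at k = n + 1.
  scaledTerm-sucˡ : ∀ n k →
    (1ℤ + + n - + k) * scaledTerm (suc n) k ≡ (1ℤ + + n + + k) * scaledTerm n k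
  scaledTerm-sucˡ n k = *-cancelˡ-≡ (+ 2 + + n + + k) _ _ ⦃ _ ⦄ (begin
    (+ 2 + + n + + k) * ((1ℤ + + n - + k) * scaledTerm (suc n) k)
      ≡⟨ reorder (+ n) (+ k) _ ⟩
    (+ suc n - + k) * (1ℤ + + suc n + + k) * scaledTerm (suc n) k
      ≡⟨ scaledTerm-sucʳ (suc n) k ⟨
    scaledTerm (suc n) (suc k)
      ≡⟨ scaledTerm-suc² n k ⟩
    (1ℤ + + n + + k) * (+ 2 + + n + + k) * scaledTerm n k
      ≡⟨ collect (+ n) (+ k) _ ⟩
    (+ 2 + + n + + k) * ((1ℤ + + n + + k) * scaledTerm n k) ∎)
    where
    reorder : ∀ n k s → (+ 2 + n + k) * ((1ℤ + n - k) * s)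
      ≡ (1ℤ + n - k) * (1ℤ + (1ℤ + n) + k) * s
    reorder = solve-∀
    collect : ∀ n k s → (1ℤ + n + k) * (+ 2 + n + k) * s ≡ (+ 2 + n + k) * ((1ℤ + n + k) * s)
    collect = solve-∀

  term-zero : ∀ n → term n 0 ≡ 1ℤ
  term-zero n = cong₂ (λ a b → + (a ℕ.* b)) (nC0≡1 n) (nC0≡1 (n ℕ.+ 0))

  -- After scaling, the sum reduces to (n + k + 2) + (n - k) = 2 (n + 1). The right-hand side is a
  -- summand of a coefficient of U^(n+1), which makes D (n + 1) + D n accessible through the series.
  term-pair : ∀ n k → term (suc n) k + term n k
    ≡ + 2 * (+ ((n ℕ.+ k) C k) * + (suc n C k))
  term-pair n zero    = cong₂ _+_ (term-zero (suc n)) (term-zero n)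
  term-pair n (suc k) = cancel-!² (suc k) (begin
    (term (suc n) (suc k) + term n (suc k)) * Q
      ≡⟨ *-distribʳ-+ Q (term (suc n) (suc k)) (term n (suc k)) ⟩
    term (suc n) (suc k) * Q + term n (suc k) * Q
      ≡⟨ cong₂ _+_ (term*!² (suc n) (suc k)) (term*!² n (suc k)) ⟩
    scaledTerm (suc n) (suc k) + scaledTerm n (suc k)
      ≡⟨ cong₂ _+_ (scaledTerm-suc² n k) (scaledTerm-sucʳ n k) ⟩
    (1ℤ + N + K) * (+ 2 + N + K) * S + (N - K) * (1ℤ + N + K) * S
      ≡⟨ add N K S ⟩
    + 2 * ((1ℤ + N) * (1ℤ + N + K) * S)
      ≡⟨ cong (+ 2 *_) (falling-product n k) ⟨
    + 2 * (falling (+ suc n) (suc k) * falling (1ℤ + (N + K)) (suc k))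
      ≡⟨ cong (λ m → + 2 * (falling (+ suc n) (suc k) * falling (+ m) (suc k))) (ℕ.+-suc n k) ⟨
    + 2 * (falling (+ suc n) (suc k) * falling (+ (n ℕ.+ suc k)) (suc k))
      ≡⟨ cong (+ 2 *_) (C*C*!² (suc n) (n ℕ.+ suc k) (suc k)) ⟨
    + 2 * (+ (suc n C suc k) * + ((n ℕ.+ suc k) C suc k) * Q)
      ≡⟨ reorder (+ (suc n C suc k)) _ Q ⟩
    + 2 * (+ ((n ℕ.+ suc k) C suc k) * + (suc n C suc k)) * Q ∎)
    where
    N = + n
    K = + k
    S = scaledTerm n k
    Q = + (suc k !) * + (suc k !)
    add : ∀ n k s → (1ℤ + n + k) * (+ 2 + n + k) * s + (n - k) * (1ℤ + n + k) * s
      ≡ + 2 * ((1ℤ + n) * (1ℤ + n + k) * s)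
    add = solve-∀
    reorder : ∀ a b q → + 2 * (a * b * q) ≡ + 2 * (b * a) * q
    reorder = solve-∀

  -- The polynomial Σ `term n k` x^k is the Legendre polynomial P_n(1 + 2x), and this is the
  -- coefficient of x^(k+1) in Bonnet's recurrence. It therefore holds term by term, without a
  -- certificate that telescopes in k. After scaling, every term is a multiple of
  -- `scaledTerm (suc n) k`.
  term-recurrence : ∀ n k →
    (+ 2 + + n) * term (2 ℕ.+ n) (suc k) + (1ℤ + + n) * term n (suc k)
      ≡ (+ 3 + + 2 * + n) * (term (suc n) (suc k) + + 2 * term (suc n) k)
  term-recurrence n k = cancel-!² (suc k) (begin
    ((+ 2 + N) * term (2 ℕ.+ n) (suc k) + (1ℤ + N) * term n (suc k)) * Q
      ≡⟨ spread N (term (2 ℕ.+ n) (suc k)) (term n (suc k)) Q ⟩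
    (+ 2 + N) * (term (2 ℕ.+ n) (suc k) * Q) + (1ℤ + N) * (term n (suc k) * Q)
      ≡⟨ cong₂ (λ x z → (+ 2 + N) * x + (1ℤ + N) * z)
           (trans (term*!² (2 ℕ.+ n) (suc k)) (scaledTerm-suc² (suc n) k))
           (trans (term*!² n (suc k)) below) ⟩
    (+ 2 + N) * ((1ℤ + (1ℤ + N) + K) * (+ 2 + (1ℤ + N) + K) * S)
      + (1ℤ + N) * ((N - K) * ((1ℤ + N - K) * S))
      ≡⟨ identity N K S ⟩
    (+ 3 + + 2 * N) * ((1ℤ + N - K) * (1ℤ + (1ℤ + N) + K) * S
      + + 2 * ((1ℤ + K) * (1ℤ + K) * S))
      ≡⟨ cong₂ (λ x z → (+ 3 + + 2 * N) * (x + + 2 * z))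
           (trans (term*!² (suc n) (suc k)) (scaledTerm-sucʳ (suc n) k)) left ⟨
    (+ 3 + + 2 * N) * (term (suc n) (suc k) * Q + + 2 * (term (suc n) k * Q))
      ≡⟨ gather N (term (suc n) (suc k)) (term (suc n) k) Q ⟩
    (+ 3 + + 2 * N) * (term (suc n) (suc k) + + 2 * term (suc n) k) * Q ∎)
    where
    N = + n
    K = + k
    S = scaledTerm (suc n) k
    Q = + (suc k !) * + (suc k !)
    below : scaledTerm n (suc k) ≡ (N - K) * ((1ℤ + N - K) * S)
    below = trans (scaledTerm-sucʳ n k)
      (trans (*-assoc (N - K) (1ℤ + N + K) (scaledTerm n k))
        (cong ((N - K) *_) (sym (scaledTerm-sucˡ n k))))
    left : term (suc n) k * Q ≡ (1ℤ + K) * (1ℤ + K) * S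
    left = trans (cong (λ f → term (suc n) k * (f * f)) (+[1+k]! k))
      (trans (reorder (term (suc n) k) K (+ (k !))) (cong ((1ℤ + K) * (1ℤ + K) *_) (term*!² (suc n) k)))
      where
      reorder : ∀ t k f → t * (((1ℤ + k) * f) * ((1ℤ + k) * f))
        ≡ (1ℤ + k) * (1ℤ + k) * (t * (f * f))
      reorder = solve-∀
    spread : ∀ n a b q → ((+ 2 + n) * a + (1ℤ + n) * b) * q
      ≡ (+ 2 + n) * (a * q) + (1ℤ + n) * (b * q)
    spread = solve-∀
    gather : ∀ n a b q → (+ 3 + + 2 * n) * (a * q + + 2 * (b * q))
      ≡ (+ 3 + + 2 * n) * (a + + 2 * b) * q
    gather = solve-∀
    identity : ∀ n k s →
      (+ 2 + n) * ((1ℤ + (1ℤ + n) + k) * (+ 2 + (1ℤ + n) + k) * s)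
        + (1ℤ + n) * ((n - k) * ((1ℤ + n - k) * s))
      ≡ (+ 3 + + 2 * n) * ((1ℤ + n - k) * (1ℤ + (1ℤ + n) + k) * s
        + + 2 * ((1ℤ + k) * (1ℤ + k) * s))
    identity = solve-∀

  -- The summands with k > n vanish. The slack d gives the Delannoy numbers of three consecutive
  -- indices one common range of summation.
  D-sum : ∀ n d → + D n ≡ ∑< (d ℕ.+ suc n) (term n)
  D-sum n zero    = pos-∑< (suc n) (λ k → (n C k) ℕ.* ((n ℕ.+ k) C k))
  D-sum n (suc d) = begin
    + D n                                              ≡⟨ D-sum n d ⟩
    ∑< (d ℕ.+ suc n) (term n)                          ≡⟨ +-identityʳ _ ⟨
    ∑< (d ℕ.+ suc n) (term n) + 0ℤ
      ≡⟨ cong (λ c → ∑< (d ℕ.+ suc n) (term n)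
                 + + (c ℕ.* ((n ℕ.+ (d ℕ.+ suc n)) C (d ℕ.+ suc n))))
           (k>n⇒nCk≡0 (ℕ.m≤n+m (suc n) d)) ⟨
    ∑< (d ℕ.+ suc n) (term n) + term n (d ℕ.+ suc n)   ≡⟨ ∑<-last (d ℕ.+ suc n) (term n) ⟨
    ∑< (suc d ℕ.+ suc n) (term n) ∎

  D-recurrence : ∀ n → (+ 2 + + n) * + D (2 ℕ.+ n) + (1ℤ + + n) * + D n
    ≡ + 3 * (+ 3 + + 2 * + n) * + D (suc n)
  D-recurrence n = begin
    (+ 2 + N) * + D (2 ℕ.+ n) + (1ℤ + N) * + D n
      ≡⟨ cong₂ (λ x z → (+ 2 + N) * x + (1ℤ + N) * z) (D-tail (2 ℕ.+ n) 0) (D-tail n 2) ⟩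
    (+ 2 + N) * (1ℤ + ∑< M (term (2 ℕ.+ n) ∘ suc)) + (1ℤ + N) * (1ℤ + ∑< M (term n ∘ suc))
      ≡⟨ expand N (∑< M (term (2 ℕ.+ n) ∘ suc)) (∑< M (term n ∘ suc)) ⟩
    (+ 3 + + 2 * N) + ((+ 2 + N) * ∑< M (term (2 ℕ.+ n) ∘ suc)
      + (1ℤ + N) * ∑< M (term n ∘ suc))
      ≡⟨ cong (_+_ (+ 3 + + 2 * N)) sums ⟩
    (+ 3 + + 2 * N) + (+ 3 + + 2 * N) * (∑< M (term (suc n) ∘ suc) + + 2 * ∑< M (term (suc n)))
      ≡⟨ collect N (∑< M (term (suc n) ∘ suc)) (∑< M (term (suc n))) ⟩
    (+ 3 + + 2 * N) * ((1ℤ + ∑< M (term (suc n) ∘ suc)) + + 2 * ∑< M (term (suc n)))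
      ≡⟨ cong₂ (λ x z → (+ 3 + + 2 * N) * (x + + 2 * z)) (D-tail (suc n) 1) (D-sum (suc n) 0) ⟨
    (+ 3 + + 2 * N) * (+ D (suc n) + + 2 * + D (suc n))
      ≡⟨ triple N (+ D (suc n)) ⟩
    + 3 * (+ 3 + + 2 * N) * + D (suc n) ∎
    where
    N = + n
    M = 2 ℕ.+ n
    D-tail : ∀ m d → + D m ≡ 1ℤ + ∑< (d ℕ.+ m) (term m ∘ suc)
    D-tail m d = trans (D-sum m d)
      (trans (cong (λ l → ∑< l (term m)) (ℕ.+-suc d m))
        (cong (λ z → z + ∑< (d ℕ.+ m) (term m ∘ suc)) (term-zero m)))
    sums : (+ 2 + N) * ∑< M (term (2 ℕ.+ n) ∘ suc) + (1ℤ + N) * ∑< M (term n ∘ suc)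
      ≡ (+ 3 + + 2 * N) * (∑< M (term (suc n) ∘ suc) + + 2 * ∑< M (term (suc n)))
    sums = begin
      (+ 2 + N) * ∑< M (term (2 ℕ.+ n) ∘ suc) + (1ℤ + N) * ∑< M (term n ∘ suc)
        ≡⟨ cong₂ _+_ (∑<-*ˡ M (+ 2 + N) (term (2 ℕ.+ n) ∘ suc)) (∑<-*ˡ M (1ℤ + N) (term n ∘ suc)) ⟨
      ∑< M (λ k → (+ 2 + N) * term (2 ℕ.+ n) (suc k)) + ∑< M (λ k → (1ℤ + N) * term n (suc k))
        ≡⟨ ∑<-+ M (λ k → (+ 2 + N) * term (2 ℕ.+ n) (suc k)) (λ k → (1ℤ + N) * term n (suc k)) ⟨
      ∑< M (λ k → (+ 2 + N) * term (2 ℕ.+ n) (suc k) + (1ℤ + N) * term n (suc k))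
        ≡⟨ ∑<-cong M (λ k _ → term-recurrence n k) ⟩
      ∑< M (λ k → (+ 3 + + 2 * N) * (term (suc n) (suc k) + + 2 * term (suc n) k))
        ≡⟨ ∑<-*ˡ M (+ 3 + + 2 * N) (λ k → term (suc n) (suc k) + + 2 * term (suc n) k) ⟩
      (+ 3 + + 2 * N) * ∑< M (λ k → term (suc n) (suc k) + + 2 * term (suc n) k)
        ≡⟨ cong ((+ 3 + + 2 * N) *_)
             (trans (∑<-+ M (term (suc n) ∘ suc) (λ k → + 2 * term (suc n) k))
               (cong (λ z → ∑< M (term (suc n) ∘ suc) + z) (∑<-*ˡ M (+ 2) (term (suc n))))) ⟩
      (+ 3 + + 2 * N) * (∑< M (term (suc n) ∘ suc) + + 2 * ∑< M (term (suc n))) ∎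
    expand : ∀ n a b → (+ 2 + n) * (1ℤ + a) + (1ℤ + n) * (1ℤ + b)
      ≡ (+ 3 + + 2 * n) + ((+ 2 + n) * a + (1ℤ + n) * b)
    expand = solve-∀
    collect : ∀ n a b → (+ 3 + + 2 * n) + (+ 3 + + 2 * n) * (a + + 2 * b)
      ≡ (+ 3 + + 2 * n) * ((1ℤ + a) + + 2 * b)
    collect = solve-∀
    triple : ∀ n d → (+ 3 + + 2 * n) * (d + + 2 * d) ≡ + 3 * (+ 3 + + 2 * n) * d
    triple = solve-∀

-- The series U = (1 + x) / (1 - x), its powers, and congruences for D n ∓ D (n - 1).

module SpecialSeries where
  open import Algebra.Bundles using (CommutativeRing)
  open import Data.Integer.Base as ℤ using (ℤ; +_; -_; _+_; _*_; _-_; 0ℤ; 1ℤ; -1ℤ)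
  open import Data.Integer.Properties
  open import Data.Integer.Tactic.RingSolver using (solve-∀)
  open import Data.Nat.Base as ℕ using (ℕ; zero; suc; _∸_)
  open import Data.Nat.Combinatorics using (_C_; nCk+nC[k+1]≡[n+1]C[k+1]; nCn≡1; nCk≡nC[n∸k])
  import Data.Nat.Properties as ℕ
  open import Data.Product.Base using (_,_; proj₁; proj₂; ∃₂; ∃-syntax; _×_)
  open import Function.Base using (_∘_)
  open import Relation.Binary.PropositionalEquality
  open IntegerSeries
  open IntegerSums
  open Doubling
  open Delannoy using (term; term-pair; D-sum; nC0≡1)
  open ∑ℤ using (∑<)
  module R = CommutativeRing seriesRing
  open import Algebra.Properties.CommutativeSemiring.Exp R.commutativeSemiring
    using (^-distrib-*) renaming (_^_ to _^ˢ_)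

  open import Algebra.Properties.Ring R.ring using ([y-z]x≈yx-zx)

  infixl 6 _⊕_
  _⊕_ : Series → Series → Series
  _⊕_ = R._+_

  X : Series
  X zero    = 0ℤ
  X (suc k) = 1ˢ k

  1+X 1-X 1/[1-X] 1/[1+X] : Series
  1+X       = 1ˢ ⊕ X
  1-X       = 1ˢ R.- X
  1/[1-X] _ = 1ℤ
  1/[1+X] k = -1ℤ ℤ.^ k

  X⊛-suc : ∀ f n → (X ⊛ f) (suc n) ≡ f n
  X⊛-suc f n = trans (+-identityˡ _) (R.*-identityˡ f n)

  1+X⊛-suc : ∀ f n → (1+X ⊛ f) (suc n) ≡ f (suc n) + f n
  1+X⊛-suc f n = trans (R.distribʳ f 1ˢ X (suc n))
    (cong₂ _+_ (R.*-identityˡ f (suc n)) (X⊛-suc f n))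

  1+X⊛1/[1+X] : 1+X ⊛ 1/[1+X] ≗ 1ˢ
  1+X⊛1/[1+X] zero    = refl
  1+X⊛1/[1+X] (suc n) = trans (1+X⊛-suc 1/[1+X] n) (lemma (-1ℤ ℤ.^ n))
    where
    lemma : ∀ a → -1ℤ * a + a ≡ 0ℤ
    lemma = solve-∀

  [1-X]+X : 1-X ⊕ X ≗ 1ˢ
  [1-X]+X k = lemma (1ˢ k) (X k)
    where
    lemma : ∀ a b → (a + - b) + b ≡ a
    lemma = solve-∀

  1-X⊛-suc : ∀ f n → (1-X ⊛ f) (suc n) ≡ f (suc n) - f n
  1-X⊛-suc f n = trans ([y-z]x≈yx-zx f 1ˢ X (suc n))
    (cong₂ _-_ (R.*-identityˡ f (suc n)) (X⊛-suc f n))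

  1-X⊛1/[1-X] : 1-X ⊛ 1/[1-X] ≗ 1ˢ
  1-X⊛1/[1-X] zero    = refl
  1-X⊛1/[1-X] (suc n) = 1-X⊛-suc 1/[1-X] n

  1+X^-coefficient : ∀ n k → (1+X ^ˢ n) k ≡ + (n C k)
  1+X^-coefficient zero    zero    = refl
  1+X^-coefficient zero    (suc k) = refl
  1+X^-coefficient (suc n) zero    = trans (*-identityˡ _) (1+X^-coefficient n 0)
  1+X^-coefficient (suc n) (suc k) = begin
    (1+X ⊛ 1+X ^ˢ n) (suc k)           ≡⟨ 1+X⊛-suc (1+X ^ˢ n) k ⟩
    (1+X ^ˢ n) (suc k) + (1+X ^ˢ n) k
      ≡⟨ cong₂ _+_ (1+X^-coefficient n (suc k)) (1+X^-coefficient n k) ⟩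
    + (n C suc k) + + (n C k)           ≡⟨ +-comm (+ (n C suc k)) (+ (n C k)) ⟩
    + (n C k) + + (n C suc k)           ≡⟨ pos-+ (n C k) (n C suc k) ⟨
    + (n C k ℕ.+ n C suc k)             ≡⟨ cong +_ (nCk+nC[k+1]≡[n+1]C[k+1] n k) ⟩
    + (suc n C suc k)                   ∎
    where open ≡-Reasoning

  -- Multiplying by 1 - X turns Pascal's rule into the recursion for the powers.
  1/[1-X]^-coefficient : ∀ n k → (1/[1-X] ^ˢ suc n) k ≡ + ((n ℕ.+ k) C k)
  1/[1-X]^-coefficient n zero = trans (at-0 n) (cong +_ (sym (nC0≡1 (n ℕ.+ 0))))
    where
    at-0 : ∀ n → (1/[1-X] ^ˢ suc n) 0 ≡ 1ℤ
    at-0 zero    = refl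
    at-0 (suc n) = trans (*-identityˡ _) (at-0 n)
  1/[1-X]^-coefficient zero (suc k) = begin
    (1/[1-X] ⊛ 1ˢ) (suc k)  ≡⟨ R.*-identityʳ 1/[1-X] (suc k) ⟩
    1ℤ                      ≡⟨ cong +_ (nCn≡1 (suc k)) ⟨
    + (suc k C suc k)       ∎
    where open ≡-Reasoning
  1/[1-X]^-coefficient (suc n) (suc k) = begin
    P (suc k)                                          ≡⟨ split (P (suc k)) (P k) ⟩
    (P (suc k) - P k) + P k                            ≡⟨ cong (λ z → z + P k) (1-X⊛-suc P k) ⟨
    (1-X ⊛ P) (suc k) + P k                            ≡⟨ cong (λ z → z + P k) (cancel (suc k)) ⟩
    (1/[1-X] ^ˢ suc n) (suc k) + P k
      ≡⟨ cong₂ _+_ (1/[1-X]^-coefficient n (suc k)) (1/[1-X]^-coefficient (suc n) k) ⟩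
    + ((n ℕ.+ suc k) C suc k) + + ((suc n ℕ.+ k) C k)
      ≡⟨ cong (λ m → + (m C suc k) + + ((suc n ℕ.+ k) C k)) (ℕ.+-suc n k) ⟩
    + ((suc n ℕ.+ k) C suc k) + + ((suc n ℕ.+ k) C k)
      ≡⟨ +-comm (+ ((suc n ℕ.+ k) C suc k)) (+ ((suc n ℕ.+ k) C k)) ⟩
    + ((suc n ℕ.+ k) C k) + + ((suc n ℕ.+ k) C suc k)
      ≡⟨ pos-+ ((suc n ℕ.+ k) C k) ((suc n ℕ.+ k) C suc k) ⟨
    + ((suc n ℕ.+ k) C k ℕ.+ (suc n ℕ.+ k) C suc k)
      ≡⟨ cong +_ (nCk+nC[k+1]≡[n+1]C[k+1] (suc n ℕ.+ k) k) ⟩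
    + ((suc (suc n ℕ.+ k)) C suc k)
      ≡⟨ cong (λ m → + (m C suc k)) (ℕ.+-suc (suc n) k) ⟨
    + ((suc n ℕ.+ suc k) C suc k)                      ∎
    where
    open ≡-Reasoning
    P : Series
    P = 1/[1-X] ^ˢ suc (suc n)
    split : ∀ a b → a ≡ (a - b) + b
    split = solve-∀
    cancel : 1-X ⊛ P ≗ 1/[1-X] ^ˢ suc n
    cancel = R.trans (R.sym (R.*-assoc 1-X 1/[1-X] (1/[1-X] ^ˢ suc n)))
      (R.trans (R.*-congʳ {1/[1-X] ^ˢ suc n} 1-X⊛1/[1-X]) (R.*-identityˡ (1/[1-X] ^ˢ suc n)))

  -- The substitution x ↦ - x.
  alternate : Series → Series
  alternate f k = -1ℤ ℤ.^ k * f k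

  alternate-⊛ : ∀ f g → alternate (f ⊛ g) ≗ alternate f ⊛ alternate g
  alternate-⊛ f g zero    = lemma (f 0) (g 0)
    where
    lemma : ∀ a b → 1ℤ * (a * b) ≡ 1ℤ * a * (1ℤ * b)
    lemma = solve-∀
  alternate-⊛ f g (suc n) = begin
    -1ℤ ℤ.^ suc n * (f 0 * g (suc n) + (f ∘ suc ⊛ g) n)
      ≡⟨ expand (-1ℤ ℤ.^ n) (f 0) (g (suc n)) ((f ∘ suc ⊛ g) n) ⟩
    1ℤ * f 0 * (-1ℤ ℤ.^ suc n * g (suc n)) + -1ℤ * alternate (f ∘ suc ⊛ g) n
      ≡⟨ cong (λ z → 1ℤ * f 0 * (-1ℤ ℤ.^ suc n * g (suc n)) + -1ℤ * z)
           (alternate-⊛ (f ∘ suc) g n) ⟩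
    1ℤ * f 0 * (-1ℤ ℤ.^ suc n * g (suc n)) + -1ℤ * (alternate (f ∘ suc) ⊛ alternate g) n
      ≡⟨ cong (_+_ (1ℤ * f 0 * (-1ℤ ℤ.^ suc n * g (suc n))))
           (⊛-scaleˡ -1ℤ (alternate (f ∘ suc)) (alternate g) n) ⟨
    1ℤ * f 0 * (-1ℤ ℤ.^ suc n * g (suc n)) + ((λ k → -1ℤ * alternate (f ∘ suc) k) ⊛ alternate g) n
      ≡⟨ cong (_+_ (1ℤ * f 0 * (-1ℤ ℤ.^ suc n * g (suc n))))
           (R.*-congʳ {alternate g} (λ k → sym (*-assoc -1ℤ (-1ℤ ℤ.^ k) (f (suc k)))) n) ⟩
    1ℤ * f 0 * (-1ℤ ℤ.^ suc n * g (suc n)) + (alternate f ∘ suc ⊛ alternate g) n ∎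
    where
    open ≡-Reasoning
    expand : ∀ s a b c → -1ℤ * s * (a * b + c) ≡ 1ℤ * a * (-1ℤ * s * b) + -1ℤ * (s * c)
    expand = solve-∀

  alternate-^ : ∀ {f g} → alternate f ≗ g → ∀ n → alternate (f ^ˢ n) ≗ g ^ˢ n
  alternate-^         eq zero    zero    = refl
  alternate-^         eq zero    (suc k) = *-zeroʳ (-1ℤ ℤ.^ suc k)
  alternate-^ {f} {g} eq (suc n) k =
    trans (alternate-⊛ f (f ^ˢ n) k) (R.*-cong eq (alternate-^ eq n) k)

  U W : Series
  U = 1+X ⊛ 1/[1-X]
  W = 1-X ⊛ 1/[1+X]

  alternate-U : alternate U ≗ W
  alternate-U k = trans (alternate-⊛ 1+X 1/[1-X] k) (R.*-cong alternate-1+X (λ k → *-identityʳ _) k)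
    where
    alternate-1+X : alternate 1+X ≗ 1-X
    alternate-1+X 0             = refl
    alternate-1+X 1             = refl
    alternate-1+X (suc (suc k)) = *-zeroʳ (-1ℤ ℤ.^ suc (suc k))

  -1^even : ∀ h → -1ℤ ℤ.^ (2 ℕ.* h) ≡ 1ℤ
  -1^even h = trans (sym (^-*-assoc -1ℤ 2 h)) (^-zeroˡ h)

  const-double : ∀ a → const (+ (2 ℕ.* a)) ≗ const (+ a) ⊕ const (+ a)
  const-double a zero    = trans (cong (λ b → + (a ℕ.+ b)) (ℕ.+-identityʳ a)) (pos-+ a a)
  const-double a (suc k) = refl

  U⊛W : U ⊛ W ≗ 1ˢ
  U⊛W = cayley-inverse R.commutativeSemiring [1-X]+X 1-X⊛1/[1-X] 1+X⊛1/[1+X]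

  -- The content used in the doubling: with m = 2^a, twice this constant is 4m. It starts at 4
  -- because U - W = 4x / ((1 - x)(1 + x)).
  twoPower : ℕ → Series
  twoPower a = const (+ (2 ℕ.^ suc a))

  difference-sum : ∀ a → let m = 2 ℕ.^ a in
    ∃₂ λ q p → (U ^ˢ m ≗ W ^ˢ m ⊕ (twoPower a ⊕ twoPower a) ⊛ q) × (U ^ˢ m ⊕ W ^ˢ m ≗ p ⊕ p)
  difference-sum = power-difference R.commutativeSemiring U W twoPower U⊛W
    (λ a → const-double (2 ℕ.^ suc a))
    ( X ⊛ (1/[1-X] ⊛ 1/[1+X])
    , (1-X ⊛ 1-X ⊕ 1-X ⊛ X ⊕ 1-X ⊛ X ⊕ X ⊛ X ⊕ X ⊛ X) ⊛ (1/[1-X] ⊛ 1/[1+X])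
    , R.trans {U} {W ⊕ ((1ˢ ⊕ 1ˢ) ⊕ (1ˢ ⊕ 1ˢ)) ⊛ (X ⊛ (1/[1-X] ⊛ 1/[1+X]))}
        (cayley-difference R.commutativeSemiring [1-X]+X 1-X⊛1/[1-X] 1+X⊛1/[1+X])
        (λ k → cong (_+_ (W k)) (R.*-congʳ {X ⊛ (1/[1-X] ⊛ 1/[1+X])}
          (λ k → sym (cong₂ _+_ (const-double 1 k) (const-double 1 k))) k))
    , cayley-sum R.commutativeSemiring [1-X]+X 1-X⊛1/[1-X] 1+X⊛1/[1+X]
    )

  scaled-square : ∀ {f} c q → f ≗ const c →
    (f ⊛ q) ⊛ (f ⊛ q) ≗ λ k → c * (c * (q ⊛ q) k)
  scaled-square {f} c q f≗c k = begin
    ((f ⊛ q) ⊛ (f ⊛ q)) k                    ≡⟨ ⊛-cong f⊛q f⊛q k ⟩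
    ((λ k → c * q k) ⊛ (λ k → c * q k)) k    ≡⟨ ⊛-scaleˡ c q (λ k → c * q k) k ⟩
    c * (q ⊛ (λ k → c * q k)) k              ≡⟨ cong (c *_) (⊛-comm q (λ k → c * q k) k) ⟩
    c * ((λ k → c * q k) ⊛ q) k              ≡⟨ cong (c *_) (⊛-scaleˡ c q q k) ⟩
    c * (c * (q ⊛ q) k)                      ∎
    where
    open ≡-Reasoning
    f⊛q : f ⊛ q ≗ λ k → c * q k
    f⊛q k = trans (⊛-cong f≗c (λ _ → refl {x = q _}) k) (const-⊛ c q k)

  U^n+W^n : ∀ a → let n = 2 ℕ.^ suc a in
    ∃[ r ] (U ^ˢ n) ⊕ (W ^ˢ n) ≗ const (+ 2) ⊕ (λ k → + (2 ℕ.* n) * (+ (2 ℕ.* n) * r k))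
  U^n+W^n a = let q , _ , diff , _ = difference-sum a in q ⊛ q ,
    R.trans {U ^ˢ n ⊕ W ^ˢ n} {U ^ˢ m ⊛ U ^ˢ m ⊕ W ^ˢ m ⊛ W ^ˢ m}
      (R.+-cong {U ^ˢ n} {U ^ˢ m ⊛ U ^ˢ m} {W ^ˢ n} {W ^ˢ m ⊛ W ^ˢ m}
        (^-double R.commutativeSemiring U m) (^-double R.commutativeSemiring W m))
    (R.trans {U ^ˢ m ⊛ U ^ˢ m ⊕ W ^ˢ m ⊛ W ^ˢ m}
        {(1ˢ ⊕ 1ˢ) ⊕ ((twoPower a ⊕ twoPower a) ⊛ q) ⊛ ((twoPower a ⊕ twoPower a) ⊛ q)}
      (double-sum R.commutativeSemiring {U ^ˢ m} {W ^ˢ m} (twoPower a) q diff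
        (^-inverse R.commutativeSemiring {U} {W} U⊛W m))
      (λ k → cong₂ _+_ (sym (const-double 1 k))
        (scaled-square (+ (2 ℕ.* n)) q (λ k → sym (const-double n k)) k)))
    where
    m = 2 ℕ.^ a
    n = 2 ℕ.^ suc a

  -- The exponents are kept independent for two uses: m = n leads to D n, and n = m + 1 to D (m + 1)
  -- + D m.
  1/[1-X]^⊛1+X^ : ∀ m n →
    (1/[1-X] ^ˢ suc m ⊛ 1+X ^ˢ n) n ≡ ∑< (suc n) (λ k → + ((m ℕ.+ k) C k) * + (n C k))
  1/[1-X]^⊛1+X^ m n = trans (⊛-coefficient (1/[1-X] ^ˢ suc m) (1+X ^ˢ n) n)
    (∑<-cong (suc n) λ k k<1+n → cong₂ _*_ (1/[1-X]^-coefficient m k)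
      (trans (1+X^-coefficient n (n ∸ k)) (cong +_ (sym (nCk≡nC[n∸k] (ℕ.s≤s⁻¹ k<1+n))))))

  -- The series is (1 + x)^n (1 - x)^-(n+1). The second factor has coefficients C(n + k, k), and the
  -- first contributes C(n, n - k) = C(n, k).
  D-series : ∀ n → (U ^ˢ n ⊛ 1/[1-X]) n ≡ + D n
  D-series n = begin
    (U ^ˢ n ⊛ 1/[1-X]) n
      ≡⟨ R.*-congʳ {1/[1-X]} (^-distrib-* 1+X 1/[1-X] n) n ⟩
    (1+X ^ˢ n ⊛ 1/[1-X] ^ˢ n ⊛ 1/[1-X]) n
      ≡⟨ rearrange n ⟩
    (1/[1-X] ^ˢ suc n ⊛ 1+X ^ˢ n) n
      ≡⟨ 1/[1-X]^⊛1+X^ n n ⟩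
    ∑< (suc n) (λ k → + ((n ℕ.+ k) C k) * + (n C k))
      ≡⟨ ∑<-cong (suc n) (λ k _ → trans (*-comm (+ ((n ℕ.+ k) C k)) (+ (n C k)))
           (sym (pos-* (n C k) ((n ℕ.+ k) C k)))) ⟩
    ∑< (suc n) (term n)
      ≡⟨ D-sum n 0 ⟨
    + D n ∎
    where
    open ≡-Reasoning
    rearrange : 1+X ^ˢ n ⊛ 1/[1-X] ^ˢ n ⊛ 1/[1-X] ≗ 1/[1-X] ^ˢ suc n ⊛ 1+X ^ˢ n
    rearrange = R.trans (R.*-assoc (1+X ^ˢ n) (1/[1-X] ^ˢ n) 1/[1-X])
      (R.trans (R.*-congˡ {1+X ^ˢ n} (R.*-comm (1/[1-X] ^ˢ n) 1/[1-X]))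
        (R.*-comm (1+X ^ˢ n) (1/[1-X] ^ˢ suc n)))

  D+D : ∀ m → + D (suc m) + + D m ≡ + 2 * (U ^ˢ suc m) (suc m)
  D+D m = begin
    + D (suc m) + + D m
      ≡⟨ cong₂ _+_ (D-sum (suc m) 0) (D-sum m 1) ⟩
    ∑< (2 ℕ.+ m) (term (suc m)) + ∑< (2 ℕ.+ m) (term m)
      ≡⟨ ∑<-+ (2 ℕ.+ m) (term (suc m)) (term m) ⟨
    ∑< (2 ℕ.+ m) (λ k → term (suc m) k + term m k)
      ≡⟨ ∑<-cong (2 ℕ.+ m) (λ k _ → term-pair m k) ⟩
    ∑< (2 ℕ.+ m) (λ k → + 2 * (+ ((m ℕ.+ k) C k) * + (suc m C k)))
      ≡⟨ ∑<-*ˡ (2 ℕ.+ m) (+ 2) (λ k → + ((m ℕ.+ k) C k) * + (suc m C k)) ⟩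
    + 2 * ∑< (2 ℕ.+ m) (λ k → + ((m ℕ.+ k) C k) * + (suc m C k))
      ≡⟨ cong (+ 2 *_) (1/[1-X]^⊛1+X^ m (suc m)) ⟨
    + 2 * (1/[1-X] ^ˢ suc m ⊛ 1+X ^ˢ suc m) (suc m)
      ≡⟨ cong (+ 2 *_) (R.*-comm (1/[1-X] ^ˢ suc m) (1+X ^ˢ suc m) (suc m)) ⟩
    + 2 * (1+X ^ˢ suc m ⊛ 1/[1-X] ^ˢ suc m) (suc m)
      ≡⟨ cong (+ 2 *_) (^-distrib-* 1+X 1/[1-X] (suc m) (suc m)) ⟨
    + 2 * (U ^ˢ suc m) (suc m) ∎
    where open ≡-Reasoning

  -- Since U / (1 + x) = 1 / (1 - x), the series P below equals U^m / (1 - x), whose coefficient at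
  -- m is D m. Multiplying P by 1 + x adds this coefficient to the next one.
  U^n⊛1/[1+X] : ∀ m → (U ^ˢ suc m ⊛ 1/[1+X]) (suc m) + + D m ≡ (U ^ˢ suc m) (suc m)
  U^n⊛1/[1+X] m = begin
    P (suc m) + + D m
      ≡⟨ cong (_+_ (P (suc m))) (trans (P≗ m) (D-series m)) ⟨
    P (suc m) + P m
      ≡⟨ 1+X⊛-suc P m ⟨
    (1+X ⊛ P) (suc m)
      ≡⟨ R.*-comm 1+X P (suc m) ⟩
    (U ^ˢ suc m ⊛ 1/[1+X] ⊛ 1+X) (suc m)
      ≡⟨ R.*-assoc (U ^ˢ suc m) 1/[1+X] 1+X (suc m) ⟩
    (U ^ˢ suc m ⊛ (1/[1+X] ⊛ 1+X)) (suc m)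
      ≡⟨ R.*-congˡ {U ^ˢ suc m} (R.trans (R.*-comm 1/[1+X] 1+X) 1+X⊛1/[1+X]) (suc m) ⟩
    (U ^ˢ suc m ⊛ 1ˢ) (suc m)
      ≡⟨ R.*-identityʳ (U ^ˢ suc m) (suc m) ⟩
    (U ^ˢ suc m) (suc m) ∎
    where
    open ≡-Reasoning
    P : Series
    P = U ^ˢ suc m ⊛ 1/[1+X]
    P≗ : P ≗ U ^ˢ m ⊛ 1/[1-X]
    P≗ k = trans (reorder R.commutativeSemiring 1+X 1/[1-X] (U ^ˢ m) 1/[1+X] k)
      (trans (R.*-congˡ {U ^ˢ m ⊛ 1/[1-X]} 1+X⊛1/[1+X] k) (R.*-identityʳ (U ^ˢ m ⊛ 1/[1-X]) k))

  -- The index enters only through its parity and through U^n + U^-n, so the exact form of n as a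
  -- power of 2 is left to the caller.
  D-congruences-from : ∀ m r → let n = suc m; c = + (2 ℕ.* n) in
    -1ℤ ℤ.^ n ≡ 1ℤ →
    U ^ˢ n ⊕ W ^ˢ n ≗ const (+ 2) ⊕ (λ k → c * (c * r k)) →
    ∃₂ λ p q → (+ D n - + D m ≡ + 2 + + 2 * (+ n * + n) * p)
             × (+ D n + + D m ≡ + 4 * (+ n * + n) * q)
  -- The coefficient T is eliminated: D n - D m is (T + D n) - (T + D m). The first part is the
  -- coefficient of (U^n + W^n) / (1 + x), giving 2 + 4n² s; the second is that of U^n, giving 2n²
  -- (r n). Hence p = 2s - r n.
  D-congruences-from m r -1^n≡1 U+W≗ = + 2 * s - r n , r n , difference , sum
    where
    open ≡-Reasoning
    n = suc m
    c = + (2 ℕ.* n)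
    N = + n
    s = (r ⊛ 1/[1+X]) n
    B = (U ^ˢ n) n
    T = (U ^ˢ n ⊛ 1/[1+X]) n

    alternate-n : ∀ f → alternate f n ≡ f n
    alternate-n f = trans (cong (_* f n) -1^n≡1) (*-identityˡ (f n))

    W^n : (W ^ˢ n) n ≡ B
    W^n = trans (sym (alternate-^ alternate-U n n)) (alternate-n (U ^ˢ n))

    B≡ : B ≡ + 2 * (N * N) * r n
    B≡ = *-cancelˡ-≡ (+ 2) B (+ 2 * (N * N) * r n) (begin
      + 2 * B                          ≡⟨ double B ⟩
      B + B                            ≡⟨ cong (_+_ B) W^n ⟨
      B + (W ^ˢ n) n                   ≡⟨ U+W≗ n ⟩
      0ℤ + c * (c * r n)               ≡⟨ cong (λ c → 0ℤ + c * (c * r n)) (pos-* 2 n) ⟩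
      0ℤ + + 2 * N * (+ 2 * N * r n)   ≡⟨ collect N (r n) ⟩
      + 2 * (+ 2 * (N * N) * r n)      ∎)
      where
      double : ∀ b → + 2 * b ≡ b + b
      double = solve-∀
      collect : ∀ n r → 0ℤ + + 2 * n * (+ 2 * n * r) ≡ + 2 * (+ 2 * (n * n) * r)
      collect = solve-∀

    D≡ : + D n ≡ (W ^ˢ n ⊛ 1/[1+X]) n
    D≡ = begin
      + D n                                        ≡⟨ D-series n ⟨
      (U ^ˢ n ⊛ 1/[1-X]) n                         ≡⟨ alternate-n (U ^ˢ n ⊛ 1/[1-X]) ⟨
      alternate (U ^ˢ n ⊛ 1/[1-X]) n               ≡⟨ alternate-⊛ (U ^ˢ n) 1/[1-X] n ⟩
      (alternate (U ^ˢ n) ⊛ alternate 1/[1-X]) n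
        ≡⟨ ⊛-cong (alternate-^ alternate-U n) (λ k → *-identityʳ (-1ℤ ℤ.^ k)) n ⟩
      (W ^ˢ n ⊛ 1/[1+X]) n                         ∎

    T+D≡ : T + + D n ≡ + 2 + + 4 * (N * N) * s
    T+D≡ = begin
      T + + D n
        ≡⟨ cong (_+_ T) D≡ ⟩
      T + (W ^ˢ n ⊛ 1/[1+X]) n
        ≡⟨ ⊛-distribʳ 1/[1+X] (U ^ˢ n) (W ^ˢ n) n ⟨
      ((U ^ˢ n ⊕ W ^ˢ n) ⊛ 1/[1+X]) n
        ≡⟨ ⊛-cong U+W≗ (λ k → refl) n ⟩
      ((const (+ 2) ⊕ (λ k → c * (c * r k))) ⊛ 1/[1+X]) n
        ≡⟨ ⊛-distribʳ 1/[1+X] (const (+ 2)) (λ k → c * (c * r k)) n ⟩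
      (const (+ 2) ⊛ 1/[1+X]) n + ((λ k → c * (c * r k)) ⊛ 1/[1+X]) n
        ≡⟨ cong₂ _+_ (trans (const-⊛ (+ 2) 1/[1+X] n) (cong (+ 2 *_) -1^n≡1))
             (trans (⊛-scaleˡ c (λ k → c * r k) 1/[1+X] n)
               (cong (c *_) (⊛-scaleˡ c r 1/[1+X] n))) ⟩
      + 2 * 1ℤ + c * (c * s)
        ≡⟨ cong (λ c → + 2 * 1ℤ + c * (c * s)) (pos-* 2 n) ⟩
      + 2 * 1ℤ + + 2 * N * (+ 2 * N * s)
        ≡⟨ collect N s ⟩
      + 2 + + 4 * (N * N) * s ∎
      where
      collect : ∀ n s → + 2 * 1ℤ + + 2 * n * (+ 2 * n * s) ≡ + 2 + + 4 * (n * n) * s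
      collect = solve-∀

    sum : + D n + + D m ≡ + 4 * (N * N) * r n
    sum = trans (D+D m) (trans (cong (+ 2 *_) B≡) (collect (N * N) (r n)))
      where
      collect : ∀ n r → + 2 * (+ 2 * n * r) ≡ + 4 * n * r
      collect = solve-∀

    difference : + D n - + D m ≡ + 2 + + 2 * (N * N) * (+ 2 * s - r n)
    difference = begin
      + D n - + D m                            ≡⟨ regroup (+ D n) (+ D m) T ⟩
      (T + + D n) - (T + + D m)                ≡⟨ cong₂ _-_ T+D≡ (trans (U^n⊛1/[1+X] m) B≡) ⟩
      (+ 2 + + 4 * (N * N) * s) - + 2 * (N * N) * r n
        ≡⟨ collect (N * N) s (r n) ⟩
      + 2 + + 2 * (N * N) * (+ 2 * s - r n)    ∎
      where
      regroup : ∀ d e t → d - e ≡ (t + d) - (t + e)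
      regroup = solve-∀
      collect : ∀ n s r → (+ 2 + + 4 * n * s) - + 2 * n * r ≡ + 2 + + 2 * n * (+ 2 * s - r)
      collect = solve-∀

  D-congruences : ∀ a m → suc m ≡ 2 ℕ.^ suc a → let n = suc m in
    ∃₂ λ p q → (+ D n - + D m ≡ + 2 + + 2 * (+ n * + n) * p)
             × (+ D n + + D m ≡ + 4 * (+ n * + n) * q)
  D-congruences a m eq = D-congruences-from m (proj₁ (U^n+W^n a))
    (trans (cong (-1ℤ ℤ.^_) eq) (-1^even (2 ℕ.^ a)))
    (subst (λ n → let c = + (2 ℕ.* n) in
        U ^ˢ n ⊕ W ^ˢ n ≗ const (+ 2) ⊕ (λ k → c * (c * proj₁ (U^n+W^n a) k)))
      (sym eq) (proj₂ (U^n+W^n a)))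

-- The binomial expansion that produces the numbers e_j.

module BinomialIdentity where
  open import Algebra.Bundles using (CommutativeSemiring)
  open import Data.Integer.Base as ℤ using (ℤ; +_; -_; _+_; _*_; _-_; 1ℤ; _^_)
  open import Data.Integer.Properties
  open import Data.Integer.Tactic.RingSolver using (solve-∀)
  open import Data.Nat.Base as ℕ using (ℕ; zero; suc; _∸_)
  open import Data.Nat.Combinatorics using (_C_)
  import Data.Nat.Properties as ℕ
  open import Function.Base using (_∘_)
  open import Relation.Binary.PropositionalEquality
  open ≡-Reasoning
  open IntegerSums
  open ∑ℤ using (∑<; ∑₁)
  open Delannoy using (nC0≡1)
  open import Algebra.Definitions.RawSemiring ℤ.+-*-rawSemiring
    using () renaming (_^_ to _^′_; _×_ to _×′_)
  import Algebra.Properties.CommutativeSemiring.Binomial +-*-commutativeSemiring as Binomial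

  ^′≡^ : ∀ i n → i ^′ n ≡ i ^ n
  ^′≡^ i zero    = refl
  ^′≡^ i (suc n) = cong (i *_) (^′≡^ i n)

  ×′≡* : ∀ n i → n ×′ i ≡ + n * i
  ×′≡* zero    i = refl
  ×′≡* (suc n) i = trans (cong (_+_ i) (×′≡* n i)) (sym (suc-* (+ n) i))

  pos-^ : ∀ m n → + (m ℕ.^ n) ≡ (+ m) ^ n
  pos-^ m zero    = refl
  pos-^ m (suc n) = trans (pos-* m (m ℕ.^ n)) (cong (+ m *_) (pos-^ m n))

  binomialTerm : ℤ → ℤ → ℕ → ℕ → ℤ
  binomialTerm c t n k = + (n C k) * (c ^ k * t ^ (n ∸ k))

  binomial : ∀ c t n → (c + t) ^ n ≡ ∑< (suc n) (binomialTerm c t n)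
  binomial c t n = begin
    (c + t) ^ n     ≡⟨ ^′≡^ (c + t) n ⟨
    (c + t) ^′ n    ≡⟨ Binomial.theorem n c t ⟩
    ∑< (suc n) (λ k → (n C k) ×′ (c ^′ k * t ^′ (n ∸ k)))
      ≡⟨ ∑<-cong (suc n) (λ k _ → trans (×′≡* (n C k) (c ^′ k * t ^′ (n ∸ k)))
           (cong (+ (n C k) *_) (cong₂ _*_ (^′≡^ c k) (^′≡^ t (n ∸ k))))) ⟩
    ∑< (suc n) (binomialTerm c t n) ∎

  -- The indices 2j - 1 and 2j are grouped because they yield the same power of t, and so together
  -- make up e_j.
  ∑<-pairs : ∀ v f → ∑< (suc (2 ℕ.* v)) f ≡ f 0 + ∑₁ v (λ j → f (2 ℕ.* j ∸ 1) + f (2 ℕ.* j))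
  ∑<-pairs zero    f = refl
  ∑<-pairs (suc v) f = begin
    ∑< (suc (2 ℕ.* suc v)) f
      ≡⟨ ∑<-last (2 ℕ.* suc v) f ⟩
    ∑< (2 ℕ.* suc v) f + f (2 ℕ.* suc v)
      ≡⟨ cong (λ m → ∑< m f + f (2 ℕ.* suc v)) (ℕ.*-suc 2 v) ⟩
    ∑< (2 ℕ.+ 2 ℕ.* v) f + f (2 ℕ.* suc v)
      ≡⟨ cong (_+ f (2 ℕ.* suc v)) (∑<-last (suc (2 ℕ.* v)) f) ⟩
    ∑< (suc (2 ℕ.* v)) f + f (suc (2 ℕ.* v)) + f (2 ℕ.* suc v)
      ≡⟨ cong₂ (λ x m → x + f (m ∸ 1) + f (2 ℕ.* suc v)) (∑<-pairs v f) (sym (ℕ.*-suc 2 v)) ⟩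
    f 0 + ∑₁ v F + f (2 ℕ.* suc v ∸ 1) + f (2 ℕ.* suc v)
      ≡⟨ regroup (f 0) (∑₁ v F) _ _ ⟩
    f 0 + (∑₁ v F + (f (2 ℕ.* suc v ∸ 1) + f (2 ℕ.* suc v)))
      ≡⟨ cong (_+_ (f 0)) (∑<-last v (F ∘ suc)) ⟨
    f 0 + ∑₁ (suc v) F ∎
    where
    F : ℕ → ℤ
    F j = f (2 ℕ.* j ∸ 1) + f (2 ℕ.* j)
    regroup : ∀ a b c d → a + b + c + d ≡ a + (b + (c + d))
    regroup = solve-∀

  ^-even : ∀ c k → c ^ (2 ℕ.* k) ≡ (c * c) ^ k
  ^-even c k = trans (sym (^-*-assoc c 2 k)) (cong (λ z → (c * z) ^ k) (*-identityʳ c))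

  pos-e : ∀ i s → + e (suc i) s
    ≡ + (s C (2 ℕ.* suc i)) * (+ 2 * (+ 4) ^ i) + + (s C (2 ℕ.* suc i ∸ 1)) * (+ 4) ^ i
  pos-e i s = trans (pos-+ (a ℕ.* 2 ℕ.^ (2 ℕ.* suc i ∸ 1)) (b ℕ.* 2 ℕ.^ (2 ℕ.* suc i ∸ 2)))
    (cong₂ _+_ (trans (pos-* a (2 ℕ.^ (2 ℕ.* suc i ∸ 1))) (cong (+ a *_) (odd i)))
      (trans (pos-* b (2 ℕ.^ (2 ℕ.* suc i ∸ 2))) (cong (+ b *_) (even i))))
    where
    a = s C (2 ℕ.* suc i)
    b = s C (2 ℕ.* suc i ∸ 1)
    even : ∀ i → + (2 ℕ.^ (2 ℕ.* suc i ∸ 2)) ≡ (+ 4) ^ i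
    even i = trans (cong (λ m → + (2 ℕ.^ (m ∸ 2))) (ℕ.*-suc 2 i))
      (trans (pos-^ 2 (2 ℕ.* i)) (^-even (+ 2) i))
    odd : ∀ i → + (2 ℕ.^ (2 ℕ.* suc i ∸ 1)) ≡ + 2 * (+ 4) ^ i
    odd i = trans (cong (λ m → + (2 ℕ.^ (m ∸ 1))) (ℕ.*-suc 2 i))
      (trans (pos-* 2 (2 ℕ.^ (2 ℕ.* i)))
        (cong (+ 2 *_) (trans (pos-^ 2 (2 ℕ.* i)) (^-even (+ 2) i))))

  binomialTerm-even : ∀ c t v i → i ℕ.< v → binomialTerm c t (2 ℕ.* v) (2 ℕ.* suc i)
    ≡ + ((2 ℕ.* v) C (2 ℕ.* suc i)) * (c * c * (c * c) ^ i * (t * t) ^ (v ∸ suc i))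
  binomialTerm-even c t v i i<v = cong (+ ((2 ℕ.* v) C (2 ℕ.* suc i)) *_)
    (cong₂ _*_ (^-even c (suc i))
      (trans (cong (t ^_) (sym (ℕ.*-distribˡ-∸ 2 v (suc i)))) (^-even t (v ∸ suc i))))

  binomialTerm-odd : ∀ c t v i → i ℕ.< v → binomialTerm c t (2 ℕ.* v) (2 ℕ.* suc i ∸ 1)
    ≡ + ((2 ℕ.* v) C (2 ℕ.* suc i ∸ 1)) * (c * (c * c) ^ i * (t * (t * t) ^ (v ∸ suc i)))
  binomialTerm-odd c t v i i<v = cong (+ ((2 ℕ.* v) C (2 ℕ.* suc i ∸ 1)) *_)
    (cong₂ _*_
      (trans (cong (λ m → c ^ (m ∸ 1)) (ℕ.*-suc 2 i)) (cong (c *_) (^-even c i)))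
      (trans (cong (t ^_) exponent) (cong (t *_) (^-even t (v ∸ suc i)))))
    where
    exponent : 2 ℕ.* v ∸ (2 ℕ.* suc i ∸ 1) ≡ suc (2 ℕ.* (v ∸ suc i))
    exponent = begin
      2 ℕ.* v ∸ (2 ℕ.* suc i ∸ 1)
        ≡⟨ cong (λ v → 2 ℕ.* v ∸ (2 ℕ.* suc i ∸ 1)) (ℕ.m+[n∸m]≡n i<v) ⟨
      2 ℕ.* (suc i ℕ.+ d) ∸ (2 ℕ.* suc i ∸ 1)
        ≡⟨ cong₂ (λ x m → x ∸ (m ∸ 1))
             (trans (ℕ.*-distribˡ-+ 2 (suc i) d) (cong (ℕ._+ 2 ℕ.* d) (ℕ.*-suc 2 i)))
             (ℕ.*-suc 2 i) ⟩
      suc (suc (2 ℕ.* i ℕ.+ 2 ℕ.* d)) ∸ suc (2 ℕ.* i)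
        ≡⟨ ℕ.+-∸-assoc 1 (ℕ.m≤m+n (2 ℕ.* i) (2 ℕ.* d)) ⟩
      suc (2 ℕ.* i ℕ.+ 2 ℕ.* d ∸ 2 ℕ.* i)
        ≡⟨ cong suc (ℕ.m+n∸m≡n (2 ℕ.* i) (2 ℕ.* d)) ⟩
      suc (2 ℕ.* d) ∎
      where d = v ∸ suc i

  -- Changing the sign of 2 changes the sign of the odd-indexed binomial terms. The even-indexed
  -- ones are thus multiplied by (t - 1) + (t + 1) = 2t and the odd-indexed ones by (t + 1) - (t -
  -- 1) = 2. Both then carry t^(2(v - j) + 1), with total coefficient 2 C(2v, 2j) 2^(2j) + 2 C(2v,
  -- 2j - 1) 2^(2j - 1) = 4 e_j.
  binomial-pair : ∀ t v → (t - 1ℤ) * (- + 2 + t) ^ (2 ℕ.* v) + (t + 1ℤ) * (+ 2 + t) ^ (2 ℕ.* v)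
    ≡ + 2 * (t * (t * t) ^ v) + ∑₁ v (λ j → + 4 * (+ e j (2 ℕ.* v) * (t * (t * t) ^ (v ∸ j))))
  binomial-pair t v = begin
    (t - 1ℤ) * (- + 2 + t) ^ n + (t + 1ℤ) * (+ 2 + t) ^ n
      ≡⟨ cong₂ (λ x z → (t - 1ℤ) * x + (t + 1ℤ) * z)
           (trans (binomial (- + 2) t n) (∑<-pairs v (p (- + 2))))
           (trans (binomial (+ 2) t n) (∑<-pairs v (p (+ 2)))) ⟩
    (t - 1ℤ) * (p (- + 2) 0 + ∑₁ v (P (- + 2))) + (t + 1ℤ) * (p (+ 2) 0 + ∑₁ v (P (+ 2)))
      ≡⟨ cong₂ (λ x z → (t - 1ℤ) * (x + ∑₁ v (P (- + 2))) + (t + 1ℤ) * (z + ∑₁ v (P (+ 2))))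
           (first (- + 2)) (first (+ 2)) ⟩
    (t - 1ℤ) * (1ℤ * (1ℤ * T) + ∑₁ v (P (- + 2))) + (t + 1ℤ) * (1ℤ * (1ℤ * T) + ∑₁ v (P (+ 2)))
      ≡⟨ expand t T (∑₁ v (P (- + 2))) (∑₁ v (P (+ 2))) ⟩
    + 2 * (t * T) + ((t - 1ℤ) * ∑₁ v (P (- + 2)) + (t + 1ℤ) * ∑₁ v (P (+ 2)))
      ≡⟨ cong (_+_ (+ 2 * (t * T)))
           (trans (cong₂ _+_ (sym (∑<-*ˡ v (t - 1ℤ) (P (- + 2) ∘ suc)))
               (sym (∑<-*ˡ v (t + 1ℤ) (P (+ 2) ∘ suc))))
             (sym (∑<-+ v (λ i → (t - 1ℤ) * P (- + 2) (suc i)) (λ i → (t + 1ℤ) * P (+ 2) (suc i))))) ⟩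
    + 2 * (t * T) + ∑₁ v (λ j → (t - 1ℤ) * P (- + 2) j + (t + 1ℤ) * P (+ 2) j)
      ≡⟨ cong (_+_ (+ 2 * (t * T))) (∑<-cong v pair) ⟩
    + 2 * (t * T) + ∑₁ v (λ j → + 4 * (+ e j n * (t * (t * t) ^ (v ∸ j)))) ∎
    where
    n = 2 ℕ.* v
    T = (t * t) ^ v
    p : ℤ → ℕ → ℤ
    p c = binomialTerm c t n
    P : ℤ → ℕ → ℤ
    P c j = p c (2 ℕ.* j ∸ 1) + p c (2 ℕ.* j)
    first : ∀ c → p c 0 ≡ 1ℤ * (1ℤ * T)
    first c = cong₂ (λ a x → + a * (1ℤ * x)) (nC0≡1 n) (^-even t v)
    expand : ∀ t x a b → (t - 1ℤ) * (1ℤ * (1ℤ * x) + a) + (t + 1ℤ) * (1ℤ * (1ℤ * x) + b)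
      ≡ + 2 * (t * x) + ((t - 1ℤ) * a + (t + 1ℤ) * b)
    expand = solve-∀
    pair : ∀ i → i ℕ.< v → (t - 1ℤ) * P (- + 2) (suc i) + (t + 1ℤ) * P (+ 2) (suc i)
      ≡ + 4 * (+ e (suc i) n * (t * (t * t) ^ (v ∸ suc i)))
    pair i i<v = begin
      (t - 1ℤ) * P (- + 2) (suc i) + (t + 1ℤ) * P (+ 2) (suc i)
        ≡⟨ cong₂ (λ x z → (t - 1ℤ) * x + (t + 1ℤ) * z)
             (cong₂ _+_ (binomialTerm-odd (- + 2) t v i i<v) (binomialTerm-even (- + 2) t v i i<v))
             (cong₂ _+_ (binomialTerm-odd (+ 2) t v i i<v) (binomialTerm-even (+ 2) t v i i<v)) ⟩
      (t - 1ℤ) * (b * (- + 2 * z * (t * τ)) + a * (+ 4 * z * τ))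
        + (t + 1ℤ) * (b * (+ 2 * z * (t * τ)) + a * (+ 4 * z * τ))
        ≡⟨ collect t a b z τ ⟩
      + 4 * ((a * (+ 2 * z) + b * z) * (t * τ))
        ≡⟨ cong (λ e → + 4 * (e * (t * τ))) (pos-e i n) ⟨
      + 4 * (+ e (suc i) n * (t * τ)) ∎
      where
      a = + (n C (2 ℕ.* suc i))
      b = + (n C (2 ℕ.* suc i ∸ 1))
      z = (+ 4) ^ i
      τ = (t * t) ^ (v ∸ suc i)
      collect : ∀ t a b z τ → (t - 1ℤ) * (b * (- + 2 * z * (t * τ)) + a * (+ 4 * z * τ))
        + (t + 1ℤ) * (b * (+ 2 * z * (t * τ)) + a * (+ 4 * z * τ))
        ≡ + 4 * ((a * (+ 2 * z) + b * z) * (t * τ))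
      collect = solve-∀

  -- With t = 2k + 1 the coefficients k and k + 1 of the adjoint recurrence are (t - 1) / 2 and (t +
  -- 1) / 2, so this is half of `binomial-pair`.
  odd-squares : ∀ k v → let t = + 2 * k + 1ℤ in
    k * ((t - + 2) * (t - + 2)) ^ v + (1ℤ + k) * ((t + + 2) * (t + + 2)) ^ v
      ≡ t * (t * t) ^ v + + 2 * ∑₁ v (λ j → + e j (2 ℕ.* v) * (t * (t * t) ^ (v ∸ j)))
  odd-squares k v = *-cancelˡ-≡ (+ 2) _ _ (begin
    + 2 * (k * ((t - + 2) * (t - + 2)) ^ v + (1ℤ + k) * ((t + + 2) * (t + + 2)) ^ v)
      ≡⟨ halve k (((t - + 2) * (t - + 2)) ^ v) (((t + + 2) * (t + + 2)) ^ v) ⟩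
    (t - 1ℤ) * ((t - + 2) * (t - + 2)) ^ v + (t + 1ℤ) * ((t + + 2) * (t + + 2)) ^ v
      ≡⟨ cong₂ (λ x z → (t - 1ℤ) * x + (t + 1ℤ) * z)
           (trans (^-even (- + 2 + t) v) (cong (λ z → (z * z) ^ v) (+-comm (- + 2) t)))
           (trans (^-even (+ 2 + t) v) (cong (λ z → (z * z) ^ v) (+-comm (+ 2) t))) ⟨
    (t - 1ℤ) * (- + 2 + t) ^ (2 ℕ.* v) + (t + 1ℤ) * (+ 2 + t) ^ (2 ℕ.* v)
      ≡⟨ binomial-pair t v ⟩
    + 2 * (t * (t * t) ^ v) + ∑₁ v (λ j → + 4 * E j)
      ≡⟨ cong (_+_ (+ 2 * (t * (t * t) ^ v))) (∑<-*ˡ v (+ 4) (E ∘ suc)) ⟩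
    + 2 * (t * (t * t) ^ v) + + 4 * ∑₁ v E
      ≡⟨ collect (t * (t * t) ^ v) (∑₁ v E) ⟩
    + 2 * (t * (t * t) ^ v + + 2 * ∑₁ v E) ∎)
    where
    t = + 2 * k + 1ℤ
    E : ℕ → ℤ
    E j = + e j (2 ℕ.* v) * (t * (t * t) ^ (v ∸ j))
    halve : ∀ k a b → + 2 * (k * a + (1ℤ + k) * b)
      ≡ (+ 2 * k + 1ℤ - 1ℤ) * a + (+ 2 * k + 1ℤ + 1ℤ) * b
    halve = solve-∀
    collect : ∀ a b → + 2 * a + + 4 * b ≡ + 2 * (a + + 2 * b)
    collect = solve-∀

-- The weighted recursion for general right-hand sides, and the telescoping sum.

module LinearRecurrence where
  open import Data.Fin.Base using (toℕ)
  open import Data.Integer.Base as ℤ using (ℤ; +_; -_; _+_; _*_; _-_; 0ℤ; 1ℤ; _^_)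
  open import Data.Integer.Properties
  open import Data.Integer.Tactic.RingSolver using (solve-∀)
  open import Data.Nat.Base as ℕ using (ℕ; zero; suc; _∸_; s≤s)
  open import Data.Nat.Induction using (<-rec)
  import Data.Nat.Properties as ℕ
  open import Data.Product.Base using (_,_; ∃-syntax)
  open import Data.Vec.Base using (Vec; lookup)
  open import Function.Base using (_∘_)
  open import Relation.Binary.PropositionalEquality
  open import Algebra.Properties.Monoid.Sum +-0-monoid using (sum-cong-≗)
  open ≡-Reasoning
  open IntegerSums
  open ∑ℤ using (∑<; ∑₁)

  v∸1+k<v : ∀ v k → k ℕ.< v → v ∸ suc k ℕ.< v
  v∸1+k<v (suc v) k _ = s≤s (ℕ.m∸n≤m v k)

  module _ (w : ℕ → ℕ → ℤ) where

    step : (ℕ → ℤ) → ∀ v → Vec ℤ v → ℤ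
    step h v prev = h v + ∑ℤ.sum (λ i → w (suc (toℕ i)) v * lookup prev i)

    -- The right-hand side h is a parameter because the solution is linear in it: identities between
    -- values, derivatives and remainders of F_v reduce to identities between their right-hand
    -- sides, and polynomials in x need not be represented at all.
    solution : (ℕ → ℤ) → ℕ → ℤ
    solution h = CourseOfValues.value (step h)

    solution-rec : ∀ h v → solution h v ≡ h v + ∑₁ v (λ j → w j v * solution h (v ∸ j))
    solution-rec h v = cong (_+_ (h v)) (sum-cong-≗ λ i →
      cong (w (suc (toℕ i)) v *_) (CourseOfValues.lookup-history (step h) v i))

    solution-unique : ∀ h f → (∀ v → f v ≡ h v + ∑₁ v (λ j → w j v * f (v ∸ j))) →
      f ≗ solution h
    solution-unique h f f-rec = <-rec _ λ v ih → begin
      f v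
        ≡⟨ f-rec v ⟩
      h v + ∑₁ v (λ j → w j v * f (v ∸ j))
        ≡⟨ cong (_+_ (h v)) (∑<-cong v λ k k<v → cong (w (suc k) v *_) (ih (v∸1+k<v v k k<v))) ⟩
      h v + ∑₁ v (λ j → w j v * solution h (v ∸ j))
        ≡⟨ solution-rec h v ⟨
      solution h v ∎

    solution-cong : ∀ {h h′} → h ≗ h′ → solution h ≗ solution h′
    solution-cong {h} {h′} eq = solution-unique h′ (solution h)
      (λ v → trans (solution-rec h v) (cong (_+ _) (eq v)))

    solution-+ : ∀ h h′ → solution (λ v → h v + h′ v) ≗ λ v → solution h v + solution h′ v
    solution-+ h h′ v = sym (solution-unique (λ v → h v + h′ v)
      (λ v → solution h v + solution h′ v) (λ v → begin
        solution h v + solution h′ v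
          ≡⟨ cong₂ _+_ (solution-rec h v) (solution-rec h′ v) ⟩
        h v + ∑₁ v (λ j → w j v * solution h (v ∸ j))
          + (h′ v + ∑₁ v (λ j → w j v * solution h′ (v ∸ j)))
          ≡⟨ interchange (h v) (h′ v) _ _ ⟩
        h v + h′ v + (∑₁ v (λ j → w j v * solution h (v ∸ j))
          + ∑₁ v (λ j → w j v * solution h′ (v ∸ j)))
          ≡⟨ cong (_+_ (h v + h′ v))
               (∑<-+ v (λ i → w (suc i) v * solution h (v ∸ suc i))
                 (λ i → w (suc i) v * solution h′ (v ∸ suc i))) ⟨
        h v + h′ v + ∑₁ v (λ j → w j v * solution h (v ∸ j) + w j v * solution h′ (v ∸ j))
          ≡⟨ cong (_+_ (h v + h′ v)) (∑<-cong v λ i _ → sym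
               (*-distribˡ-+ (w (suc i) v) (solution h (v ∸ suc i)) (solution h′ (v ∸ suc i)))) ⟩
        h v + h′ v + ∑₁ v (λ j → w j v * (solution h (v ∸ j) + solution h′ (v ∸ j))) ∎) v)
      where
      interchange : ∀ a b x y → a + x + (b + y) ≡ a + b + (x + y)
      interchange = solve-∀

    solution-* : ∀ c h → solution (λ v → c * h v) ≗ λ v → c * solution h v
    solution-* c h v = sym (solution-unique (λ v → c * h v) (λ v → c * solution h v) (λ v → begin
      c * solution h v
        ≡⟨ cong (c *_) (solution-rec h v) ⟩
      c * (h v + ∑₁ v (λ j → w j v * solution h (v ∸ j)))
        ≡⟨ *-distribˡ-+ c (h v) _ ⟩
      c * h v + c * ∑₁ v (λ j → w j v * solution h (v ∸ j))
        ≡⟨ cong (_+_ (c * h v)) (∑<-*ˡ v c (λ i → w (suc i) v * solution h (v ∸ suc i))) ⟨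
      c * h v + ∑₁ v (λ j → c * (w j v * solution h (v ∸ j)))
        ≡⟨ cong (_+_ (c * h v)) (∑<-cong v λ i _ →
             swap c (w (suc i) v) (solution h (v ∸ suc i))) ⟩
      c * h v + ∑₁ v (λ j → w j v * (c * solution h (v ∸ j))) ∎) v)
      where
      swap : ∀ c w x → c * (w * x) ≡ w * (c * x)
      swap = solve-∀

    -- The value F_v(x) of the integral polynomial of the overview, for the weights `w`.
    power : ℤ → ℕ → ℤ
    power x = solution (x ^_)

    -- The derivative of x ↦ power x v at x = 1.
    slope : ℕ → ℤ
    slope = solution (λ v → + v)

    -- By linearity it suffices to expand (1 + x)^v as 1 + x v + x² `remainder v`. The recursion of
    -- `remainder` is the x² part of (1 + x)(1 + x v + x² r), so the second-order term stays
    -- integral.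
    power-taylor : ∀ x v → ∃[ r ] power (1ℤ + x) v ≡ power 1ℤ v + (x * slope v + x * x * r)
    power-taylor x v = solution remainder v , (begin
      power (1ℤ + x) v
        ≡⟨ solution-cong expansion v ⟩
      solution (λ v → 1ℤ ^ v + (x * + v + x * x * remainder v)) v
        ≡⟨ solution-+ (1ℤ ^_) (λ v → x * + v + x * x * remainder v) v ⟩
      power 1ℤ v + solution (λ v → x * + v + x * x * remainder v) v
        ≡⟨ cong (_+_ (power 1ℤ v)) (solution-+ (λ v → x * + v) (λ v → x * x * remainder v) v) ⟩
      power 1ℤ v + (solution (λ v → x * + v) v + solution (λ v → x * x * remainder v) v)
        ≡⟨ cong (_+_ (power 1ℤ v))
             (cong₂ _+_ (solution-* x (λ v → + v) v) (solution-* (x * x) remainder v)) ⟩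
      power 1ℤ v + (x * slope v + x * x * solution remainder v) ∎)
      where
      remainder : ℕ → ℤ
      remainder zero    = 0ℤ
      remainder (suc v) = (1ℤ + x) * remainder v + + v
      expansion : ∀ v → (1ℤ + x) ^ v ≡ 1ℤ ^ v + (x * + v + x * x * remainder v)
      expansion zero    = base x
        where
        base : ∀ x → 1ℤ ≡ 1ℤ + (x * 0ℤ + x * x * 0ℤ)
        base = solve-∀
      expansion (suc v) = begin
        (1ℤ + x) * (1ℤ + x) ^ v
          ≡⟨ cong ((1ℤ + x) *_) (trans (expansion v)
               (cong (_+ (x * + v + x * x * remainder v)) (^-zeroˡ v))) ⟩
        (1ℤ + x) * (1ℤ + (x * + v + x * x * remainder v))
          ≡⟨ collect x (+ v) (remainder v) ⟩
        1ℤ + (x * (1ℤ + + v) + x * x * remainder (suc v))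
          ≡⟨ cong (_+ (x * (1ℤ + + v) + x * x * remainder (suc v))) (^-zeroˡ (suc v)) ⟨
        1ℤ ^ suc v + (x * + suc v + x * x * remainder (suc v)) ∎
        where
        collect : ∀ x v r → (1ℤ + x) * (1ℤ + (x * v + x * x * r))
          ≡ 1ℤ + (x * (1ℤ + v) + x * x * ((1ℤ + x) * r + v))
        collect = solve-∀

    -- The adjoint of the three-term recurrence maps power ((2 k + 1)²) v to a monomial.
    power-adjoint : ∀ σ → (∀ i v → (1ℤ - σ) * w (suc i) v ≡ - + 2 * + e (suc i) (2 ℕ.* v)) →
      ∀ k v → let t = + 2 * k + 1ℤ in
      k * power ((t - + 2) * (t - + 2)) v + (1ℤ + k) * power ((t + + 2) * (t + + 2)) v
        + - (σ * t) * power (t * t) v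
      ≡ (1ℤ - σ) * (t * (t * t) ^ v)
    power-adjoint σ w≡ k v = begin
      k * power s₋ v + (1ℤ + k) * power s₊ v + - (σ * t) * power (t * t) v
        ≡⟨ cong₂ _+_ (cong₂ _+_ (solution-* k (s₋ ^_) v) (solution-* (1ℤ + k) (s₊ ^_) v))
             (solution-* (- (σ * t)) ((t * t) ^_) v) ⟨
      solution (λ v → k * s₋ ^ v) v + solution (λ v → (1ℤ + k) * s₊ ^ v) v
        + solution (λ v → - (σ * t) * (t * t) ^ v) v
        ≡⟨ cong (_+ solution (λ v → - (σ * t) * (t * t) ^ v) v)
             (solution-+ (λ v → k * s₋ ^ v) (λ v → (1ℤ + k) * s₊ ^ v) v) ⟨
      solution (λ v → k * s₋ ^ v + (1ℤ + k) * s₊ ^ v) v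
        + solution (λ v → - (σ * t) * (t * t) ^ v) v
        ≡⟨ solution-+ (λ v → k * s₋ ^ v + (1ℤ + k) * s₊ ^ v) (λ v → - (σ * t) * (t * t) ^ v) v ⟨
      solution h v
        ≡⟨ solution-unique h monomial monomial-rec v ⟨
      (1ℤ - σ) * (t * (t * t) ^ v) ∎
      where
      t = + 2 * k + 1ℤ
      s₋ = (t - + 2) * (t - + 2)
      s₊ = (t + + 2) * (t + + 2)
      h monomial : ℕ → ℤ
      h v = k * s₋ ^ v + (1ℤ + k) * s₊ ^ v + - (σ * t) * (t * t) ^ v
      monomial v = (1ℤ - σ) * (t * (t * t) ^ v)
      E : ℕ → ℕ → ℤ
      E v j = + e j (2 ℕ.* v) * (t * (t * t) ^ (v ∸ j))
      -- The weights are chosen for this cancellation: the expansion of the neighbouring squares in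
      -- h contributes + 2 Σ E, and (1 - σ) w = - 2 e makes the weighted sum contribute - 2 Σ E.
      -- Uniqueness then identifies the monomial with the combination of powers.
      monomial-rec : ∀ v → monomial v ≡ h v + ∑₁ v (λ j → w j v * monomial (v ∸ j))
      monomial-rec v = sym (begin
        h v + ∑₁ v (λ j → w j v * monomial (v ∸ j))
          ≡⟨ cong₂ _+_
               (cong (_+ - (σ * t) * (t * t) ^ v) (BinomialIdentity.odd-squares k v))
               (∑<-cong v (λ i _ → trans (assoc (w (suc i) v) (1ℤ - σ) (t * (t * t) ^ (v ∸ suc i)))
                 (trans (cong (_* (t * (t * t) ^ (v ∸ suc i))) (w≡ i v))
                   (*-assoc (- + 2) (+ e (suc i) (2 ℕ.* v)) (t * (t * t) ^ (v ∸ suc i)))))) ⟩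
        t * (t * t) ^ v + + 2 * ∑₁ v (E v) + - (σ * t) * (t * t) ^ v
          + ∑₁ v (λ j → - + 2 * E v j)
          ≡⟨ cong (_+_ (t * (t * t) ^ v + + 2 * ∑₁ v (E v) + - (σ * t) * (t * t) ^ v))
               (∑<-*ˡ v (- + 2) (E v ∘ suc)) ⟩
        t * (t * t) ^ v + + 2 * ∑₁ v (E v) + - (σ * t) * (t * t) ^ v + - + 2 * ∑₁ v (E v)
          ≡⟨ cancel σ t ((t * t) ^ v) (∑₁ v (E v)) ⟩
        (1ℤ - σ) * (t * (t * t) ^ v) ∎)
        where
        assoc : ∀ w c x → w * (c * x) ≡ c * w * x
        assoc = solve-∀
        cancel : ∀ σ t x s → t * x + + 2 * s + - (σ * t) * x + - + 2 * s ≡ (1ℤ - σ) * (t * x)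
        cancel = solve-∀

  -- The discrete Lagrange identity: pairing X with the adjoint of its recurrence applied to a
  -- leaves only the boundary Casoratian. The hypothesis on X 1 is the recurrence at n = -1, so
  -- there is no contribution from the lower end; the value chosen for `ℕ.pred 0` is multiplied by
  -- 0.
  telescope : ∀ σ (X a : ℕ → ℤ) →
    X 1 ≡ σ * X 0 →
    (∀ n → (+ 2 + + n) * X (2 ℕ.+ n) + (1ℤ + + n) * X n ≡ σ * (+ 3 + + 2 * + n) * X (suc n)) →
    ∀ m → ∑< (suc m) (λ k → (+ k * a (ℕ.pred k) + (1ℤ + + k) * a (suc k)
              + - (σ * (+ 2 * + k + 1ℤ)) * a k) * X k)
        ≡ (1ℤ + + m) * (X m * a (suc m) - X (suc m) * a m)
  telescope σ X a X1 X-rec zero = trans (initial σ (a 0) (a 1) (X 0))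
    (cong (λ x → (1ℤ + 0ℤ) * (X 0 * a 1 - x * a 0)) (sym X1))
    where
    initial : ∀ σ a₀ a₁ x → (0ℤ * a₀ + (1ℤ + 0ℤ) * a₁ + - (σ * (+ 2 * 0ℤ + 1ℤ)) * a₀) * x + 0ℤ
      ≡ (1ℤ + 0ℤ) * (x * a₁ - σ * x * a₀)
    initial = solve-∀
  telescope σ X a X1 X-rec (suc m) = begin
    ∑< (2 ℕ.+ m) F
      ≡⟨ ∑<-last (suc m) F ⟩
    ∑< (suc m) F + F (suc m)
      ≡⟨ cong (_+ F (suc m)) (telescope σ X a X1 X-rec m) ⟩
    (1ℤ + + m) * (X m * a (suc m) - X (suc m) * a m) + F (suc m)
      ≡⟨ regroup σ (+ m) (a m) (a (suc m)) (a (2 ℕ.+ m)) (X m) (X (suc m)) ⟩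
    (+ 2 + + m) * (X (suc m) * a (2 ℕ.+ m)) + (1ℤ + + m) * X m * a (suc m)
      - σ * (+ 3 + + 2 * + m) * X (suc m) * a (suc m)
      ≡⟨ cong (λ x → (+ 2 + + m) * (X (suc m) * a (2 ℕ.+ m)) + (1ℤ + + m) * X m * a (suc m)
           - x * a (suc m)) (X-rec m) ⟨
    (+ 2 + + m) * (X (suc m) * a (2 ℕ.+ m)) + (1ℤ + + m) * X m * a (suc m)
      - ((+ 2 + + m) * X (2 ℕ.+ m) + (1ℤ + + m) * X m) * a (suc m)
      ≡⟨ collect (+ m) (a (suc m)) (a (2 ℕ.+ m)) (X m) (X (suc m)) (X (2 ℕ.+ m)) ⟩
    (1ℤ + + suc m) * (X (suc m) * a (2 ℕ.+ m) - X (2 ℕ.+ m) * a (suc m)) ∎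
    where
    F : ℕ → ℤ
    F k = (+ k * a (ℕ.pred k) + (1ℤ + + k) * a (suc k) + - (σ * (+ 2 * + k + 1ℤ)) * a k) * X k
    regroup : ∀ σ m a₀ a₁ a₂ x₀ x₁ → (1ℤ + m) * (x₀ * a₁ - x₁ * a₀)
      + ((1ℤ + m) * a₀ + (1ℤ + (1ℤ + m)) * a₂ + - (σ * (+ 2 * (1ℤ + m) + 1ℤ)) * a₁) * x₁
      ≡ (+ 2 + m) * (x₁ * a₂) + (1ℤ + m) * x₀ * a₁ - σ * (+ 3 + + 2 * m) * x₁ * a₁
    regroup = solve-∀
    collect : ∀ m a₁ a₂ x₀ x₁ x₂ → (+ 2 + m) * (x₁ * a₂) + (1ℤ + m) * x₀ * a₁
      - ((+ 2 + m) * x₂ + (1ℤ + m) * x₀) * a₁ ≡ (1ℤ + (1ℤ + m)) * (x₁ * a₂ - x₂ * a₁)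
    collect = solve-∀

-- The odd moments of D k and (-1)ᵏ D k, and their reduction modulo n³.

module OddMoments where
  open import Data.Integer.Base as ℤ using (ℤ; +_; -_; _+_; _*_; _-_; 1ℤ; -1ℤ; _^_)
  open import Data.Integer.Properties
  open import Data.Integer.Tactic.RingSolver using (solve-∀)
  open import Data.Nat.Base as ℕ using (ℕ; zero; suc; _∸_)
  open import Data.Integer.Divisibility.Signed using (divides; ∣⇒∣ᵤ)
  open import Data.Nat.Combinatorics using (_C_; nC1≡n)
  open import Data.Nat.Divisibility using (_∣_; ∣m∣n⇒∣m+n; n∣m*n; m∣m*n; ∣n⇒∣m*n)
  open import Data.Nat.DivMod using (m*[n/m]≡n)
  import Data.Nat.Properties as ℕ
  open import Data.Product.Base using (_,_; proj₁; proj₂; ∃-syntax)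
  open import Relation.Binary.PropositionalEquality
  open ≡-Reasoning
  open IntegerSums
  open BinomialIdentity using (pos-^; ^-even)
  open Delannoy using (D-recurrence)
  open SpecialSeries using (D-congruences; -1^even)
  open LinearRecurrence
  open ∑ℤ using (∑<)

  odd : ℕ → ℤ
  odd k = + 2 * + k + 1ℤ

  oddPower : ℕ → ℕ → ℤ
  oddPower v k = odd k * (odd k * odd k) ^ v

  -- Applied with σ = 3, w = e to D k, and with σ = -3, w = -e / 2 to (-1)ᵏ D k. The condition `w≡`
  -- determines the weights from σ.
  module _ (w : ℕ → ℕ → ℤ) (σ : ℤ)
    (w≡ : ∀ i v → (1ℤ - σ) * w (suc i) v ≡ - + 2 * + e (suc i) (2 ℕ.* v))
    (X : ℕ → ℤ) (X1 : X 1 ≡ σ * X 0)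
    (X-rec : ∀ n → (+ 2 + + n) * X (2 ℕ.+ n) + (1ℤ + + n) * X n
               ≡ σ * (+ 3 + + 2 * + n) * X (suc n))
    where

    moment-closed : ∀ v m → (1ℤ - σ) * ∑< (suc m) (λ k → oddPower v k * X k)
      ≡ (1ℤ + + m) * (X m * power w (odd (suc m) * odd (suc m)) v
                    - X (suc m) * power w (odd m * odd m) v)
    moment-closed v m = begin
      (1ℤ - σ) * ∑< (suc m) (λ k → oddPower v k * X k)
        ≡⟨ ∑<-*ˡ (suc m) (1ℤ - σ) (λ k → oddPower v k * X k) ⟨
      ∑< (suc m) (λ k → (1ℤ - σ) * (oddPower v k * X k))
        ≡⟨ ∑<-cong (suc m) (λ k _ → summand k) ⟩
      ∑< (suc m) (λ k → (+ k * a (ℕ.pred k) + (1ℤ + + k) * a (suc k) + - (σ * odd k) * a k) * X k)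
        ≡⟨ telescope σ X a X1 X-rec m ⟩
      (1ℤ + + m) * (X m * a (suc m) - X (suc m) * a m) ∎
      where
      a : ℕ → ℤ
      a k = power w (odd k * odd k) v
      below : ∀ k → + k * a (ℕ.pred k) ≡ + k * power w ((odd k - + 2) * (odd k - + 2)) v
      -- The truncated predecessor does no harm at 0, where the factor k vanishes.
      below zero    = refl
      below (suc k) = cong (λ t → + suc k * power w (t * t) v) (lemma (+ k))
        where
        lemma : ∀ k → + 2 * k + 1ℤ ≡ + 2 * (1ℤ + k) + 1ℤ - + 2
        lemma = solve-∀
      above : ∀ k → a (suc k) ≡ power w ((odd k + + 2) * (odd k + + 2)) v
      above k = cong (λ t → power w (t * t) v) (lemma (+ k))
        where
        lemma : ∀ k → + 2 * (1ℤ + k) + 1ℤ ≡ + 2 * k + 1ℤ + + 2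
        lemma = solve-∀
      summand : ∀ k → (1ℤ - σ) * (oddPower v k * X k)
        ≡ (+ k * a (ℕ.pred k) + (1ℤ + + k) * a (suc k) + - (σ * odd k) * a k) * X k
      summand k = trans (sym (*-assoc (1ℤ - σ) (oddPower v k) (X k)))
        (cong (_* X k) (trans (sym (power-adjoint w σ w≡ (+ k) v))
          (cong₂ (λ x z → x + (1ℤ + + k) * z + - (σ * odd k) * a k)
            (sym (below k)) (sym (above k)))))

    -- The arguments are (2N ± 1)² = 1 + 4N (N ± 1). The quadratic Taylor terms thus carry 16N², and
    -- with the outer N they remain multiples of N³ after division by -2 or 4. The linear terms are
    -- regrouped so that X occurs only through the sum and the difference of its last two values.
    moment-expansion : ∀ v m → let N = + suc m in ∃[ z ]
      (1ℤ - σ) * ∑< (suc m) (λ k → oddPower v k * X k)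
      ≡ N * (- (X (suc m) - X m) * power w 1ℤ v
          + + 4 * N * (slope w v * ((X (suc m) + X m) - N * (X (suc m) - X m)))
          + + 16 * (N * N) * z)
    moment-expansion v m = z , (begin
      (1ℤ - σ) * ∑< (suc m) (λ k → oddPower v k * X k)
        ≡⟨ moment-closed v m ⟩
      N * (X m * power w (odd (suc m) * odd (suc m)) v - X (suc m) * power w (odd m * odd m) v)
        ≡⟨ cong₂ (λ p q → N * (X m * p - X (suc m) * q))
             (trans (cong (λ x → power w x v) (square₊ N)) (proj₂ (power-taylor w x₊ v)))
             (trans (cong (λ x → power w x v) (square₋ (+ m))) (proj₂ (power-taylor w x₋ v))) ⟩
      N * (X m * (power w 1ℤ v + (x₊ * slope w v + x₊ * x₊ * r₊))
        - X (suc m) * (power w 1ℤ v + (x₋ * slope w v + x₋ * x₋ * r₋)))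
        ≡⟨ collect N (X m) (X (suc m)) (power w 1ℤ v) (slope w v) r₊ r₋ ⟩
      N * (- (X (suc m) - X m) * power w 1ℤ v
        + + 4 * N * (slope w v * ((X (suc m) + X m) - N * (X (suc m) - X m)))
        + + 16 * (N * N) * z) ∎)
      where
      N = + suc m
      x₊ = + 4 * (N * (N + 1ℤ))
      x₋ = + 4 * (N * (N - 1ℤ))
      r₊ = proj₁ (power-taylor w x₊ v)
      r₋ = proj₁ (power-taylor w x₋ v)
      z = X m * ((N + 1ℤ) * (N + 1ℤ) * r₊) - X (suc m) * ((N - 1ℤ) * (N - 1ℤ) * r₋)
      square₊ : ∀ n → (+ 2 * n + 1ℤ) * (+ 2 * n + 1ℤ) ≡ 1ℤ + + 4 * (n * (n + 1ℤ))
      square₊ = solve-∀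
      square₋ : ∀ m → (+ 2 * m + 1ℤ) * (+ 2 * m + 1ℤ) ≡ 1ℤ + + 4 * ((1ℤ + m) * (1ℤ + m - 1ℤ))
      square₋ = solve-∀
      collect : ∀ n x y p g r s →
        n * (x * (p + (+ 4 * (n * (n + 1ℤ)) * g
                       + + 4 * (n * (n + 1ℤ)) * (+ 4 * (n * (n + 1ℤ))) * r))
           - y * (p + (+ 4 * (n * (n - 1ℤ)) * g
                       + + 4 * (n * (n - 1ℤ)) * (+ 4 * (n * (n - 1ℤ))) * s)))
        ≡ n * (- (y - x) * p + + 4 * n * (g * ((y + x) - n * (y - x)))
          + + 16 * (n * n) * (x * ((n + 1ℤ) * (n + 1ℤ) * r) - y * ((n - 1ℤ) * (n - 1ℤ) * s)))
      collect = solve-∀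

  -- All powers of 2 in e_j are even except 2^(2j - 2) for j = 1; there the binomial coefficient is
  -- C(2v, 1) = 2v.
  2∣e : ∀ i v → 2 ∣ e (suc i) (2 ℕ.* v)
  2∣e zero    v = ∣m∣n⇒∣m+n (n∣m*n ((2 ℕ.* v) C 2))
    (subst (2 ∣_) (sym (trans (ℕ.*-identityʳ ((2 ℕ.* v) C 1)) (nC1≡n (2 ℕ.* v)))) (m∣m*n v))
  2∣e (suc i) v = subst (λ j → 2 ∣ ((2 ℕ.* v) C j) ℕ.* 2 ℕ.^ (j ∸ 1)
      ℕ.+ ((2 ℕ.* v) C (j ∸ 1)) ℕ.* 2 ℕ.^ (j ∸ 2))
    (sym (trans (ℕ.*-suc 2 (suc i)) (cong (2 ℕ.+_) (ℕ.*-suc 2 i))))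
    (∣m∣n⇒∣m+n (∣n⇒∣m*n ((2 ℕ.* v) C (4 ℕ.+ 2 ℕ.* i)) (m∣m*n (2 ℕ.^ suc (suc (2 ℕ.* i)))))
      (∣n⇒∣m*n ((2 ℕ.* v) C (3 ℕ.+ 2 ℕ.* i)) (m∣m*n (2 ℕ.^ suc (2 ℕ.* i)))))

  halfE : ℕ → ℕ → ℕ
  halfE j v = e j (2 ℕ.* v) ℕ./ 2

  2*halfE : ∀ i v → 2 ℕ.* halfE (suc i) v ≡ e (suc i) (2 ℕ.* v)
  2*halfE i v = m*[n/m]≡n (2∣e i v)

  weight alternatingWeight : ℕ → ℕ → ℤ
  weight            j v = + e j (2 ℕ.* v)
  alternatingWeight j v = - + halfE j v

  alternatingWeight≡ : ∀ i v →
    (1ℤ - - + 3) * alternatingWeight (suc i) v ≡ - + 2 * + e (suc i) (2 ℕ.* v)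
  alternatingWeight≡ i v = begin
    + 4 * - + halfE (suc i) v          ≡⟨ lemma (+ halfE (suc i) v) ⟩
    - + 2 * (+ 2 * + halfE (suc i) v)  ≡⟨ cong (- + 2 *_) (pos-* 2 (halfE (suc i) v)) ⟨
    - + 2 * + (2 ℕ.* halfE (suc i) v)  ≡⟨ cong (λ x → - + 2 * + x) (2*halfE i v) ⟩
    - + 2 * + e (suc i) (2 ℕ.* v)      ∎
    where
    lemma : ∀ h → + 4 * - h ≡ - + 2 * (+ 2 * h)
    lemma = solve-∀

  alternatingD : ℕ → ℤ
  alternatingD k = -1ℤ ^ k * + D k

  alternatingD-recurrence : ∀ n →
    (+ 2 + + n) * alternatingD (2 ℕ.+ n) + (1ℤ + + n) * alternatingD n
      ≡ - + 3 * (+ 3 + + 2 * + n) * alternatingD (suc n)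
  alternatingD-recurrence n = begin
    (+ 2 + + n) * alternatingD (2 ℕ.+ n) + (1ℤ + + n) * alternatingD n
      ≡⟨ factor (+ n) (-1ℤ ^ n) (+ D (2 ℕ.+ n)) (+ D n) ⟩
    -1ℤ ^ n * ((+ 2 + + n) * + D (2 ℕ.+ n) + (1ℤ + + n) * + D n)
      ≡⟨ cong (-1ℤ ^ n *_) (D-recurrence n) ⟩
    -1ℤ ^ n * (+ 3 * (+ 3 + + 2 * + n) * + D (suc n))
      ≡⟨ unfactor (+ n) (-1ℤ ^ n) (+ D (suc n)) ⟩
    - + 3 * (+ 3 + + 2 * + n) * alternatingD (suc n) ∎
    where
    factor : ∀ n s a b → (+ 2 + n) * (-1ℤ * (-1ℤ * s) * a) + (1ℤ + n) * (s * b)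
      ≡ s * ((+ 2 + n) * a + (1ℤ + n) * b)
    factor = solve-∀
    unfactor : ∀ n s a → s * (+ 3 * (+ 3 + + 2 * n) * a) ≡ - + 3 * (+ 3 + + 2 * n) * (-1ℤ * s * a)
    unfactor = solve-∀

  oddPower-cast : ∀ v k → + ((2 ℕ.* k ℕ.+ 1) ℕ.^ (2 ℕ.* v ℕ.+ 1) ℕ.* D k) ≡ oddPower v k * + D k
  oddPower-cast v k = trans (pos-* ((2 ℕ.* k ℕ.+ 1) ℕ.^ (2 ℕ.* v ℕ.+ 1)) (D k))
    (cong (_* + D k) (begin
      + ((2 ℕ.* k ℕ.+ 1) ℕ.^ (2 ℕ.* v ℕ.+ 1))  ≡⟨ pos-^ (2 ℕ.* k ℕ.+ 1) (2 ℕ.* v ℕ.+ 1) ⟩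
      (+ (2 ℕ.* k ℕ.+ 1)) ^ (2 ℕ.* v ℕ.+ 1)
        ≡⟨ cong₂ _^_ (trans (pos-+ (2 ℕ.* k) 1) (cong (_+ 1ℤ) (pos-* 2 k))) (ℕ.+-comm (2 ℕ.* v) 1) ⟩
      odd k * odd k ^ (2 ℕ.* v)                ≡⟨ cong (odd k *_) (^-even (odd k) v) ⟩
      oddPower v k                             ∎))

  mod-cube : ∀ {s r} n z → s ≡ r + + n * (+ n * + n) * z → s ≡ r [mod n ℕ.^ 3 ]
  mod-cube {s} {r} n z eq = ∣⇒∣ᵤ (divides z (begin
    s - r                              ≡⟨ cong (_- r) eq ⟩
    r + + n * (+ n * + n) * z - r      ≡⟨ collect r (+ n) z ⟩
    z * (+ n) ^ 3                      ≡⟨ cong (z *_) (pos-^ n 3) ⟨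
    z * + (n ℕ.^ 3)                    ∎))
    where
    collect : ∀ r n z → r + n * (n * n) * z - r ≡ z * (n * (n * (n * 1ℤ)))
    collect = solve-∀

  -- Here 1 - σ = -2. The difference D n - D m ≡ 2 turns the value term into -2 G N. The slope term
  -- reaches order N³, because D n + D m is a multiple of 4N² and the difference is accompanied by
  -- an additional N. `Z` is the rest divided by -2 N³.
  moment-congruence : ∀ v a m → suc m ≡ 2 ℕ.^ suc a → let n = suc m in
    ∑< n (λ k → + ((2 ℕ.* k ℕ.+ 1) ℕ.^ (2 ℕ.* v ℕ.+ 1) ℕ.* D k))
      ≡ power weight 1ℤ v * + n [mod n ℕ.^ 3 ]
  moment-congruence v a m eq = mod-cube n Z (*-cancelˡ-≡ (- + 2) _ _ (begin
    - + 2 * ∑< n (λ k → + ((2 ℕ.* k ℕ.+ 1) ℕ.^ (2 ℕ.* v ℕ.+ 1) ℕ.* D k))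
      ≡⟨ cong (- + 2 *_) (∑<-cong n (λ k _ → oddPower-cast v k)) ⟩
    - + 2 * ∑< n (λ k → oddPower v k * + D k)
      ≡⟨ proj₂ expansion ⟩
    N * (- (+ D n - + D m) * G + + 4 * N * (g * ((+ D n + + D m) - N * (+ D n - + D m)))
      + + 16 * (N * N) * z)
      ≡⟨ cong₂ (λ δ s → N * (- δ * G + + 4 * N * (g * (s - N * δ)) + + 16 * (N * N) * z))
           (proj₁ (proj₂ (proj₂ congruences))) (proj₂ (proj₂ (proj₂ congruences))) ⟩
    N * (- (+ 2 + + 2 * (N * N) * p) * G
      + + 4 * N * (g * (+ 4 * (N * N) * q - N * (+ 2 + + 2 * (N * N) * p))) + + 16 * (N * N) * z)
      ≡⟨ collect N G g p q z ⟩
    - + 2 * (G * N + N * (N * N) * Z) ∎))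
    where
    n = suc m
    N = + n
    G = power weight 1ℤ v
    g = slope weight v
    congruences = D-congruences a m eq
    p = proj₁ congruences
    q = proj₁ (proj₂ congruences)
    expansion = moment-expansion weight (+ 3) (λ i v → refl) (λ k → + D k) refl D-recurrence v m
    z = proj₁ expansion
    Z = p * G + (+ 4 * g + + 4 * (N * N) * g * p - + 8 * N * g * q) - + 8 * z
    collect : ∀ n f g p q z → n * (- (+ 2 + + 2 * (n * n) * p) * f
      + + 4 * n * (g * (+ 4 * (n * n) * q - n * (+ 2 + + 2 * (n * n) * p))) + + 16 * (n * n) * z)
      ≡ - + 2 * (f * n + n * (n * n)
          * (p * f + (+ 4 * g + + 4 * (n * n) * g * p - + 8 * n * g * q) - + 8 * z))
    collect = solve-∀

  -- Here 1 - σ = 4. For even n the signs at n and m = n - 1 are opposite, so sum and difference of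
  -- the last two Delannoy numbers change places. The value term is multiplied by 4N² q and drops
  -- out, while the slope term meets D n - D m ≡ 2 and leaves 8 g N², which is 4 times the claimed
  -- main term.
  alternating-moment-congruence : ∀ v a m → suc m ≡ 2 ℕ.^ suc a → let n = suc m in
    ∑< n (λ k → -1ℤ ^ k * + ((2 ℕ.* k ℕ.+ 1) ℕ.^ (2 ℕ.* v ℕ.+ 1) ℕ.* D k))
      ≡ + 2 * slope alternatingWeight v * + (n ℕ.^ 2) [mod n ℕ.^ 3 ]
  alternating-moment-congruence v a m eq = mod-cube n Z (*-cancelˡ-≡ (+ 4) _ _ (begin
    + 4 * ∑< n (λ k → -1ℤ ^ k * + ((2 ℕ.* k ℕ.+ 1) ℕ.^ (2 ℕ.* v ℕ.+ 1) ℕ.* D k))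
      ≡⟨ cong (+ 4 *_) (∑<-cong n (λ k _ → trans (cong (-1ℤ ^ k *_) (oddPower-cast v k))
           (swap (-1ℤ ^ k) (oddPower v k) (+ D k)))) ⟩
    + 4 * ∑< n (λ k → oddPower v k * alternatingD k)
      ≡⟨ proj₂ expansion ⟩
    N * (- (alternatingD n - alternatingD m) * G
      + + 4 * N * (g * ((alternatingD n + alternatingD m) - N * (alternatingD n - alternatingD m)))
      + + 16 * (N * N) * z)
      ≡⟨ cong₂ (λ x y → N * (- (x - y) * G + + 4 * N * (g * ((x + y) - N * (x - y)))
             + + 16 * (N * N) * z)) D-n D-m ⟩
    N * (- (+ D n - - + D m) * G
      + + 4 * N * (g * ((+ D n - + D m) - N * (+ D n - - + D m))) + + 16 * (N * N) * z)
      ≡⟨ cong₂ (λ δ s → N * (- s * G + + 4 * N * (g * (δ - N * s)) + + 16 * (N * N) * z))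
           (proj₁ (proj₂ (proj₂ congruences)))
           (trans (cong (_+_ (+ D n)) (neg-involutive (+ D m)))
             (proj₂ (proj₂ (proj₂ congruences)))) ⟩
    N * (- (+ 4 * (N * N) * q) * G
      + + 4 * N * (g * ((+ 2 + + 2 * (N * N) * p) - N * (+ 4 * (N * N) * q))) + + 16 * (N * N) * z)
      ≡⟨ collect N G g p q z ⟩
    + 4 * (+ 2 * g * (N * (N * 1ℤ)) + N * (N * N) * Z)
      ≡⟨ cong (λ s → + 4 * (+ 2 * g * s + N * (N * N) * Z)) (pos-^ n 2) ⟨
    + 4 * (+ 2 * g * + (n ℕ.^ 2) + N * (N * N) * Z) ∎))
    where
    n = suc m
    N = + n
    G = power alternatingWeight 1ℤ v
    g = slope alternatingWeight v
    congruences = D-congruences a m eq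
    p = proj₁ congruences
    q = proj₁ (proj₂ congruences)
    expansion = moment-expansion alternatingWeight (- + 3) alternatingWeight≡
      alternatingD refl alternatingD-recurrence v m
    z = proj₁ expansion
    Z = - (q * G) + + 2 * N * g * p - + 4 * (N * N) * g * q + + 4 * z
    swap : ∀ s x d → s * (x * d) ≡ x * (s * d)
    swap = solve-∀
    -1^n : -1ℤ ^ n ≡ 1ℤ
    -1^n = trans (cong (-1ℤ ^_) eq) (-1^even (2 ℕ.^ a))
    D-n : alternatingD n ≡ + D n
    D-n = trans (cong (_* + D n) -1^n) (*-identityˡ (+ D n))
    D-m : alternatingD m ≡ - + D m
    D-m = trans (negate (-1ℤ ^ m) (+ D m))
      (cong -_ (trans (cong (_* + D m) -1^n) (*-identityˡ (+ D m))))
      where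
      negate : ∀ s d → s * d ≡ - (-1ℤ * s * d)
      negate = solve-∀
    collect : ∀ n f g p q z → n * (- (+ 4 * (n * n) * q) * f
      + + 4 * n * (g * ((+ 2 + + 2 * (n * n) * p) - n * (+ 4 * (n * n) * q))) + + 16 * (n * n) * z)
      ≡ + 4 * (+ 2 * g * (n * (n * 1ℤ)) + n * (n * n)
          * (- (q * f) + + 2 * n * g * p - + 4 * (n * n) * g * q + + 4 * z))
    collect = solve-∀

-- The rational polynomials y and ỹ at -1, compared with the integral solutions.

module RationalPolynomials where
  open import Data.Integer.Base as ℤ using (ℤ; +_; 1ℤ)
  import Data.Integer.Properties as ℤ
  open import Data.List.Base using ([]; _∷_)
  open import Data.Nat.Base as ℕ using (ℕ; zero; suc; _∸_)
  open import Data.Nat.Induction using (<-rec)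
  import Data.Nat.Properties as ℕ
  open import Data.Rational.Base
  open import Data.Rational.Properties
  open import Data.Rational.Solver using (module +-*-Solver)
  import Data.Rational.Unnormalised.Base as ℚᵘ
  import Data.Rational.Unnormalised.Properties as ℚᵘ
  open import Function.Base using (_∘_)
  open import Relation.Binary.PropositionalEquality
  open ≡-Reasoning
  open +-*-Solver
  open LinearRecurrence
  open OddMoments using (weight; alternatingWeight; halfE; 2*halfE)
  open ∑ℚ using (∑<; ∑₁)

  ι : ℤ → ℚ
  ι i = i / 1

  -- The quotient `i / 1` is normalised, so the homomorphism laws of `ι` are checked on unnormalised
  -- representatives, where denominators 1 multiply directly.
  toℚᵘ-ι : ∀ i → toℚᵘ (ι i) ℚᵘ.≃ ℚᵘ.mkℚᵘ i 0
  toℚᵘ-ι i = toℚᵘ-fromℚᵘ (ℚᵘ.mkℚᵘ i 0)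

  ι-+ : ∀ i j → ι (i ℤ.+ j) ≡ ι i + ι j
  ι-+ i j = toℚᵘ-injective (ℚᵘ.≃-trans (toℚᵘ-ι (i ℤ.+ j))
    (ℚᵘ.≃-trans (ℚᵘ.*≡* (cong (ℤ._* 1ℤ)
        (cong₂ ℤ._+_ (sym (ℤ.*-identityʳ i)) (sym (ℤ.*-identityʳ j)))))
      (ℚᵘ.≃-sym (ℚᵘ.≃-trans (toℚᵘ-homo-+ (ι i) (ι j)) (ℚᵘ.+-cong (toℚᵘ-ι i) (toℚᵘ-ι j))))))

  ι-* : ∀ i j → ι (i ℤ.* j) ≡ ι i * ι j
  ι-* i j = toℚᵘ-injective (ℚᵘ.≃-trans (toℚᵘ-ι (i ℤ.* j))
    (ℚᵘ.≃-trans (ℚᵘ.*≡* refl)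
      (ℚᵘ.≃-sym (ℚᵘ.≃-trans (toℚᵘ-homo-* (ι i) (ι j)) (ℚᵘ.*-cong (toℚᵘ-ι i) (toℚᵘ-ι j))))))

  ι-neg : ∀ i → ι (ℤ.- i) ≡ - ι i
  ι-neg i = trans (cong ι (sym (ℤ.-1*i≡-i i))) (trans (ι-* ℤ.-1ℤ i) (sym (neg-mul (ι i))))
    where
    neg-mul : ∀ q → - q ≡ - 1ℚ * q
    neg-mul = solve 1 (λ q → :- q := :- con 1ℚ :* q) refl

  halve : ∀ h → + (2 ℕ.* h) / 2 ≡ ι (+ h)
  halve h = fromℚᵘ-cong {ℚᵘ.mkℚᵘ (+ (2 ℕ.* h)) 1} {ℚᵘ.mkℚᵘ (+ h) 0}
    (ℚᵘ.*≡* (trans (ℤ.*-identityʳ (+ (2 ℕ.* h)))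
      (trans (ℤ.pos-* 2 h) (ℤ.*-comm (+ 2) (+ h)))))

  ∑<-cong : ∀ n {f g : ℕ → ℚ} → (∀ k → k ℕ.< n → f k ≡ g k) → ∑< n f ≡ ∑< n g
  ∑<-cong zero    eq = refl
  ∑<-cong (suc n) eq =
    cong₂ _+_ (eq 0 ℕ.z<s) (∑<-cong n (λ k k<n → eq (suc k) (ℕ.s<s k<n)))

  ∑<-*ˡ : ∀ n c f → ∑< n (λ k → c * f k) ≡ c * ∑< n f
  ∑<-*ˡ zero    c f = sym (*-zeroʳ c)
  ∑<-*ˡ (suc n) c f =
    trans (cong (_+_ (c * f 0)) (∑<-*ˡ n c (f ∘ suc))) (sym (*-distribˡ-+ c (f 0) _))

  ι-∑< : ∀ n f → ι (∑ℤ.∑< n f) ≡ ∑< n (ι ∘ f)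
  ι-∑< zero    f = refl
  ι-∑< (suc n) f = trans (ι-+ (f 0) (∑ℤ.∑< n (f ∘ suc))) (cong (_+_ (ι (f 0))) (ι-∑< n (f ∘ suc)))

  module _ (x : ℚ) where

    eval-+ₚ : ∀ p q → eval (p +ₚ q) x ≡ eval p x + eval q x
    eval-+ₚ []      q       = sym (+-identityˡ (eval q x))
    eval-+ₚ (a ∷ p) []      = sym (+-identityʳ (eval (a ∷ p) x))
    eval-+ₚ (a ∷ p) (b ∷ q) = trans (cong (λ r → a + b + x * r) (eval-+ₚ p q))
      (solve 5 (λ a b x p q → a :+ b :+ x :* (p :+ q) := (a :+ x :* p) :+ (b :+ x :* q))
        refl a b x (eval p x) (eval q x))

    eval-·ₚ : ∀ c p → eval (c ·ₚ p) x ≡ c * eval p x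
    eval-·ₚ c []      = sym (*-zeroʳ c)
    eval-·ₚ c (a ∷ p) = trans (cong (λ r → c * a + x * r) (eval-·ₚ c p))
      (solve 4 (λ c a x p → c :* a :+ x :* (c :* p) := c :* (a :+ x :* p))
        refl c a x (eval p x))

    eval--ₚ : ∀ p → eval (-ₚ p) x ≡ - eval p x
    eval--ₚ []      = refl
    eval--ₚ (a ∷ p) = trans (cong (λ r → - a + x * r) (eval--ₚ p))
      (solve 3 (λ a x p → :- a :+ x :* (:- p) := :- (a :+ x :* p)) refl a x (eval p x))

    eval-*ₚ : ∀ p q → eval (p *ₚ q) x ≡ eval p x * eval q x
    eval-*ₚ []      q = sym (*-zeroˡ (eval q x))
    eval-*ₚ (a ∷ p) q = trans (eval-+ₚ (a ·ₚ q) (0ℚ ∷ p *ₚ q))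
      (trans (cong₂ (λ r s → r + (0ℚ + x * s)) (eval-·ₚ a q) (eval-*ₚ p q))
        (solve 4 (λ a q x p → a :* q :+ (con 0ℚ :+ x :* (p :* q)) := (a :+ x :* p) :* q)
          refl a (eval q x) x (eval p x)))

    -- `derivFrom i` multiplies the l-th coefficient by i + l, so raising i by one adds every
    -- coefficient once more. For i = 0 it is the Euler operator x d/dx.
    eval-derivFrom-suc : ∀ i p →
      eval (derivFrom (suc i) p) x ≡ eval (derivFrom i p) x + eval p x
    eval-derivFrom-suc i []      = refl
    eval-derivFrom-suc i (a ∷ p) =
      trans (cong₂ (λ c r → c * a + x * r) (ι-+ 1ℤ (+ i)) (eval-derivFrom-suc (suc i) p))
        (solve 5 (λ i a x r p → (con 1ℚ :+ i) :* a :+ x :* (r :+ p)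
            := (i :* a :+ x :* r) :+ (a :+ x :* p))
          refl (ι (+ i)) a x (eval (derivFrom (suc i) p) x) (eval p x))

    derivative : Poly → ℚ
    derivative p = eval (deriv p) x

    eval-derivFrom-0 : ∀ p → eval (derivFrom 0 p) x ≡ x * derivative p
    eval-derivFrom-0 []      = sym (*-zeroʳ x)
    eval-derivFrom-0 (a ∷ p) =
      trans (cong (_+ x * derivative (a ∷ p)) (*-zeroˡ a)) (+-identityˡ _)

    -- The product rule for a + x p. It removes the running index of `derivFrom`, so that the rules
    -- below are plain inductions on the coefficient list.
    derivative-∷ : ∀ a p → derivative (a ∷ p) ≡ x * derivative p + eval p x
    derivative-∷ a p =
      trans (eval-derivFrom-suc 0 p) (cong (_+ eval p x) (eval-derivFrom-0 p))

    derivative-+ₚ : ∀ p q → derivative (p +ₚ q) ≡ derivative p + derivative q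
    derivative-+ₚ []      q       = sym (+-identityˡ (derivative q))
    derivative-+ₚ (a ∷ p) []      = sym (+-identityʳ (derivative (a ∷ p)))
    derivative-+ₚ (a ∷ p) (b ∷ q) = begin
      derivative (a + b ∷ (p +ₚ q))
        ≡⟨ derivative-∷ (a + b) (p +ₚ q) ⟩
      x * derivative (p +ₚ q) + eval (p +ₚ q) x
        ≡⟨ cong₂ (λ r s → x * r + s) (derivative-+ₚ p q) (eval-+ₚ p q) ⟩
      x * (derivative p + derivative q) + (eval p x + eval q x)
        ≡⟨ solve 5 (λ x p q r s → x :* (p :+ q) :+ (r :+ s) := (x :* p :+ r) :+ (x :* q :+ s))
             refl x (derivative p) (derivative q) (eval p x) (eval q x) ⟩
      (x * derivative p + eval p x) + (x * derivative q + eval q x)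
        ≡⟨ cong₂ _+_ (derivative-∷ a p) (derivative-∷ b q) ⟨
      derivative (a ∷ p) + derivative (b ∷ q) ∎

    derivative-·ₚ : ∀ c p → derivative (c ·ₚ p) ≡ c * derivative p
    derivative-·ₚ c []      = sym (*-zeroʳ c)
    derivative-·ₚ c (a ∷ p) = begin
      derivative (c * a ∷ c ·ₚ p)                     ≡⟨ derivative-∷ (c * a) (c ·ₚ p) ⟩
      x * derivative (c ·ₚ p) + eval (c ·ₚ p) x
        ≡⟨ cong₂ (λ r s → x * r + s) (derivative-·ₚ c p) (eval-·ₚ c p) ⟩
      x * (c * derivative p) + c * eval p x
        ≡⟨ solve 4 (λ x c p r → x :* (c :* p) :+ c :* r := c :* (x :* p :+ r))
             refl x c (derivative p) (eval p x) ⟩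
      c * (x * derivative p + eval p x)               ≡⟨ cong (c *_) (derivative-∷ a p) ⟨
      c * derivative (a ∷ p)                          ∎

    derivative--ₚ : ∀ p → derivative (-ₚ p) ≡ - derivative p
    derivative--ₚ []      = refl
    derivative--ₚ (a ∷ p) = begin
      derivative (- a ∷ -ₚ p)                       ≡⟨ derivative-∷ (- a) (-ₚ p) ⟩
      x * derivative (-ₚ p) + eval (-ₚ p) x
        ≡⟨ cong₂ (λ r s → x * r + s) (derivative--ₚ p) (eval--ₚ p) ⟩
      x * (- derivative p) + - eval p x
        ≡⟨ solve 3 (λ x p r → x :* (:- p) :+ :- r := :- (x :* p :+ r))
             refl x (derivative p) (eval p x) ⟩
      - (x * derivative p + eval p x)               ≡⟨ cong -_ (derivative-∷ a p) ⟨
      - derivative (a ∷ p)                          ∎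

    derivative-*ₚ : ∀ p q →
      derivative (p *ₚ q) ≡ derivative p * eval q x + eval p x * derivative q
    derivative-*ₚ []      q =
      solve 2 (λ r s → con 0ℚ := con 0ℚ :* r :+ con 0ℚ :* s) refl (eval q x) (derivative q)
    derivative-*ₚ (a ∷ p) q = begin
      derivative (a ·ₚ q +ₚ (0ℚ ∷ p *ₚ q))
        ≡⟨ derivative-+ₚ (a ·ₚ q) (0ℚ ∷ p *ₚ q) ⟩
      derivative (a ·ₚ q) + derivative (0ℚ ∷ p *ₚ q)
        ≡⟨ cong₂ _+_ (derivative-·ₚ a q) (trans (derivative-∷ 0ℚ (p *ₚ q))
             (cong₂ (λ r s → x * r + s) (derivative-*ₚ p q) (eval-*ₚ p q))) ⟩
      a * derivative q + (x * (derivative p * eval q x + eval p x * derivative q)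
        + eval p x * eval q x)
        ≡⟨ solve 6 (λ a q′ x p′ q p → a :* q′ :+ (x :* (p′ :* q :+ p :* q′) :+ p :* q)
               := (x :* p′ :+ p) :* q :+ (a :+ x :* p) :* q′)
             refl a (derivative q) x (derivative p) (eval q x) (eval p x) ⟩
      (x * derivative p + eval p x) * eval q x + (a + x * eval p x) * derivative q
        ≡⟨ cong (λ r → r * eval q x + (a + x * eval p x) * derivative q) (derivative-∷ a p) ⟨
      derivative (a ∷ p) * eval q x + eval (a ∷ p) x * derivative q ∎

    eval-∑ₚ : ∀ n f → eval (∑ₚ.∑< n f) x ≡ ∑< n (λ k → eval (f k) x)
    eval-∑ₚ zero    f = refl
    eval-∑ₚ (suc n) f = trans (eval-+ₚ (f 0) (∑ₚ.∑< n (f ∘ suc)))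
      (cong (_+_ (eval (f 0) x)) (eval-∑ₚ n (f ∘ suc)))

    derivative-∑ₚ : ∀ n f → derivative (∑ₚ.∑< n f) ≡ ∑< n (λ k → derivative (f k))
    derivative-∑ₚ zero    f = refl
    derivative-∑ₚ (suc n) f = trans (derivative-+ₚ (f 0) (∑ₚ.∑< n (f ∘ suc)))
      (cong (_+_ (derivative (f 0))) (derivative-∑ₚ n (f ∘ suc)))

  eval-2X+3^ : ∀ n → eval (2X+3 ^ₚ n) (- 1ℚ) ≡ 1ℚ
  eval-2X+3^ zero    = refl
  eval-2X+3^ (suc n) = trans (eval-*ₚ (- 1ℚ) 2X+3 (2X+3 ^ₚ n))
    (trans (cong (1ℚ *_) (eval-2X+3^ n)) refl)

  derivative-2X+3^ : ∀ n → derivative (- 1ℚ) (2X+3 ^ₚ n) ≡ ι (+ (2 ℕ.* n))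
  derivative-2X+3^ zero    = refl
  derivative-2X+3^ (suc n) = begin
    derivative (- 1ℚ) (2X+3 ^ₚ suc n)
      ≡⟨ derivative-*ₚ (- 1ℚ) 2X+3 (2X+3 ^ₚ n) ⟩
    ι (+ 2) * eval (2X+3 ^ₚ n) (- 1ℚ) + 1ℚ * derivative (- 1ℚ) (2X+3 ^ₚ n)
      ≡⟨ cong₂ (λ r s → ι (+ 2) * r + 1ℚ * s) (eval-2X+3^ n) (derivative-2X+3^ n) ⟩
    ι (+ 2) + 1ℚ * ι (+ (2 ℕ.* n))
      ≡⟨ cong (_+_ (ι (+ 2))) (*-identityˡ (ι (+ (2 ℕ.* n)))) ⟩
    ι (+ 2) + ι (+ (2 ℕ.* n))
      ≡⟨ ι-+ (+ 2) (+ (2 ℕ.* n)) ⟨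
    ι (+ (2 ℕ.+ 2 ℕ.* n))
      ≡⟨ cong (ι ∘ +_) (ℕ.*-suc 2 n) ⟨
    ι (+ (2 ℕ.* suc n)) ∎

  powerTail slopeTail : ℕ → ℤ
  powerTail v = ∑ℤ.∑₁ v (λ j → weight j v ℤ.* power weight 1ℤ (v ∸ j))
  slopeTail v = ∑ℤ.∑₁ v (λ j → alternatingWeight j v ℤ.* slope alternatingWeight (v ∸ j))

  -- Both are read off at 2k + 3 = 1. In the second, the derivative of ¼ F((2k + 3)²) in k is (2k +
  -- 3) F'((2k + 3)²), so no constant remains.
  YClaim ỸClaim : ℕ → Set
  YClaim v = eval (y v) (- 1ℚ) ≡ - ½ * ι (power weight 1ℤ v)
  ỸClaim v = derivative (- 1ℚ) (ỹ v) ≡ ι (slope alternatingWeight v)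

  -- The claim is assumed only below v, so that the same computation serves inside the induction and
  -- again for ρ, whose definition contains this sum.
  y-tail : ∀ v → (∀ u → u ℕ.< v → YClaim u) →
    ∑₁ v (λ j → ι (+ e j (2 ℕ.* v)) * eval (y (v ∸ j)) (- 1ℚ))
      ≡ - ½ * ι (powerTail v)
  y-tail v claim = begin
    ∑₁ v (λ j → ι (weight j v) * eval (y (v ∸ j)) (- 1ℚ))
      ≡⟨ ∑<-cong v (λ k k<v → trans (cong (ι (weight (suc k) v) *_) (claim _ (v∸1+k<v v k k<v)))
           (trans (swap (ι (weight (suc k) v)) (- ½) (ι (power weight 1ℤ (v ∸ suc k))))
             (cong (- ½ *_) (sym (ι-* (weight (suc k) v) (power weight 1ℤ (v ∸ suc k))))))) ⟩
    ∑₁ v (λ j → - ½ * ι (weight j v ℤ.* power weight 1ℤ (v ∸ j)))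
      ≡⟨ ∑<-*ˡ v (- ½) (λ k → ι (weight (suc k) v ℤ.* power weight 1ℤ (v ∸ suc k))) ⟩
    - ½ * ∑₁ v (λ j → ι (weight j v ℤ.* power weight 1ℤ (v ∸ j)))
      ≡⟨ cong (- ½ *_) (ι-∑< v (λ k → weight (suc k) v ℤ.* power weight 1ℤ (v ∸ suc k))) ⟨
    - ½ * ι (powerTail v) ∎
    where
    swap : ∀ a b c → a * (b * c) ≡ b * (a * c)
    swap = solve 3 (λ a b c → a :* (b :* c) := b :* (a :* c)) refl

  ι-power : ∀ v → ι (power weight 1ℤ v)
    ≡ 1ℚ + ι (powerTail v)
  ι-power v = trans (cong ι (solution-rec weight (1ℤ ℤ.^_) v))
    (trans (ι-+ (1ℤ ℤ.^ v) (powerTail v)) (cong (λ z → ι z + ι (powerTail v)) (ℤ.^-zeroˡ v)))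

  y-eval : ∀ v → YClaim v
  y-eval = <-rec YClaim λ where
    zero    _     → refl
    (suc u) claim → let v = suc u in begin
      eval (y v) (- 1ℚ)
        ≡⟨ cong (λ p → eval p (- 1ℚ)) (y-suc u) ⟩
      eval ((- ½) ·ₚ 2X+3 ^ₚ (2 ℕ.* v) +ₚ ∑ₚ.∑₁ v (λ j → ι (+ e j (2 ℕ.* v)) ·ₚ y (v ∸ j))) (- 1ℚ)
        ≡⟨ eval-+ₚ (- 1ℚ) ((- ½) ·ₚ 2X+3 ^ₚ (2 ℕ.* v)) _ ⟩
      eval ((- ½) ·ₚ 2X+3 ^ₚ (2 ℕ.* v)) (- 1ℚ)
        + eval (∑ₚ.∑₁ v (λ j → ι (+ e j (2 ℕ.* v)) ·ₚ y (v ∸ j))) (- 1ℚ)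
        ≡⟨ cong₂ _+_
             (trans (eval-·ₚ (- 1ℚ) (- ½) (2X+3 ^ₚ (2 ℕ.* v)))
               (cong (- ½ *_) (eval-2X+3^ (2 ℕ.* v))))
             (trans (eval-∑ₚ (- 1ℚ) v (λ k → ι (+ e (suc k) (2 ℕ.* v)) ·ₚ y (v ∸ suc k)))
               (trans (∑<-cong v (λ k _ →
                   eval-·ₚ (- 1ℚ) (ι (+ e (suc k) (2 ℕ.* v))) (y (v ∸ suc k))))
                 (y-tail v (λ _ → claim)))) ⟩
      - ½ * 1ℚ + - ½ * ι (powerTail v)
        ≡⟨ *-distribˡ-+ (- ½) 1ℚ (ι (powerTail v)) ⟨
      - ½ * (1ℚ + ι (powerTail v))
        ≡⟨ cong (- ½ *_) (ι-power v) ⟨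
      - ½ * ι (power weight 1ℤ v) ∎

  ρ≡power : ∀ v → ρ v ≡ ι (power weight 1ℤ v)
  ρ≡power v = begin
    ρ v
      ≡⟨ cong (λ s → 1ℚ - ι (+ 2) * s) (y-tail v (λ u _ → y-eval u)) ⟩
    1ℚ - ι (+ 2) * (- ½ * ι (powerTail v))
      ≡⟨ solve 1 (λ s → con 1ℚ :- con (ι (+ 2)) :* (con (- ½) :* s) := con 1ℚ :+ s) refl (ι (powerTail v)) ⟩
    1ℚ + ι (powerTail v)
      ≡⟨ ι-power v ⟨
    ι (power weight 1ℤ v) ∎

  ỹ-tail : ∀ v → (∀ u → u ℕ.< v → ỸClaim u) →
    ∑₁ v (λ j → ι (+ halfE j v) * derivative (- 1ℚ) (ỹ (v ∸ j)))
      ≡ - 1ℚ * ι (slopeTail v)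
  ỹ-tail v claim = begin
    ∑₁ v (λ j → ι (+ halfE j v) * derivative (- 1ℚ) (ỹ (v ∸ j)))
      ≡⟨ ∑<-cong v (λ k k<v → trans (cong (ι (+ halfE (suc k) v) *_) (claim _ (v∸1+k<v v k k<v)))
           (trans (negate (ι (+ halfE (suc k) v)) (ι (slope alternatingWeight (v ∸ suc k))))
             (cong (- 1ℚ *_) (trans
               (cong (_* ι (slope alternatingWeight (v ∸ suc k))) (sym (ι-neg (+ halfE (suc k) v))))
               (sym (ι-* (alternatingWeight (suc k) v) (slope alternatingWeight (v ∸ suc k)))))))) ⟩
    ∑₁ v (λ j → - 1ℚ * ι (alternatingWeight j v ℤ.* slope alternatingWeight (v ∸ j)))
      ≡⟨ ∑<-*ˡ v (- 1ℚ)
           (λ k → ι (alternatingWeight (suc k) v ℤ.* slope alternatingWeight (v ∸ suc k))) ⟩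
    - 1ℚ * ∑₁ v (λ j → ι (alternatingWeight j v ℤ.* slope alternatingWeight (v ∸ j)))
      ≡⟨ cong (- 1ℚ *_)
           (ι-∑< v (λ k → alternatingWeight (suc k) v ℤ.* slope alternatingWeight (v ∸ suc k))) ⟨
    - 1ℚ * ι (slopeTail v) ∎
    where
    negate : ∀ a b → a * b ≡ - 1ℚ * (- a * b)
    negate = solve 2 (λ a b → a :* b := con (- 1ℚ) :* (:- a :* b)) refl

  ι-slope : ∀ v → ι (slope alternatingWeight v)
    ≡ ι (+ v) + ι (slopeTail v)
  ι-slope v = trans (cong ι (solution-rec alternatingWeight (λ v → + v) v)) (ι-+ (+ v) (slopeTail v))

  ỹ-derivative : ∀ v → ỸClaim v
  ỹ-derivative = <-rec ỸClaim λ where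
    zero    _     → refl
    (suc u) claim → let v = suc u in begin
      derivative (- 1ℚ) (ỹ v)
        ≡⟨ cong (derivative (- 1ℚ)) (ỹ-suc u) ⟩
      derivative (- 1ℚ) ((+ 1 / 4) ·ₚ 2X+3 ^ₚ (2 ℕ.* v)
        +ₚ -ₚ ∑ₚ.∑₁ v (λ j → (+ e j (2 ℕ.* v) / 2) ·ₚ ỹ (v ∸ j)))
        ≡⟨ derivative-+ₚ (- 1ℚ) ((+ 1 / 4) ·ₚ 2X+3 ^ₚ (2 ℕ.* v)) _ ⟩
      derivative (- 1ℚ) ((+ 1 / 4) ·ₚ 2X+3 ^ₚ (2 ℕ.* v))
        + derivative (- 1ℚ) (-ₚ ∑ₚ.∑₁ v (λ j → (+ e j (2 ℕ.* v) / 2) ·ₚ ỹ (v ∸ j)))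
        ≡⟨ cong₂ _+_
             (trans (derivative-·ₚ (- 1ℚ) (+ 1 / 4) (2X+3 ^ₚ (2 ℕ.* v)))
               (cong ((+ 1 / 4) *_) (derivative-2X+3^ (2 ℕ.* v))))
             (trans (derivative--ₚ (- 1ℚ) (∑ₚ.∑₁ v (λ j → (+ e j (2 ℕ.* v) / 2) ·ₚ ỹ (v ∸ j))))
               (cong -_ (trans
                 (derivative-∑ₚ (- 1ℚ) v (λ k → (+ e (suc k) (2 ℕ.* v) / 2) ·ₚ ỹ (v ∸ suc k)))
                 (trans (∑<-cong v (λ k _ →
                     trans (derivative-·ₚ (- 1ℚ) (+ e (suc k) (2 ℕ.* v) / 2) (ỹ (v ∸ suc k)))
                       (cong (_* derivative (- 1ℚ) (ỹ (v ∸ suc k)))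
                         (trans (cong (λ a → + a / 2) (sym (2*halfE k v))) (halve (halfE (suc k) v))))))
                   (ỹ-tail v (λ _ → claim)))))) ⟩
      (+ 1 / 4) * ι (+ (2 ℕ.* (2 ℕ.* v))) + - (- 1ℚ * ι (slopeTail v))
        ≡⟨ cong (λ a → (+ 1 / 4) * a + - (- 1ℚ * ι (slopeTail v)))
             (trans (cong (ι ∘ +_) (sym (ℕ.*-assoc 2 2 v)))
               (trans (cong ι (ℤ.pos-* 4 v)) (ι-* (+ 4) (+ v)))) ⟩
      (+ 1 / 4) * (ι (+ 4) * ι (+ v)) + - (- 1ℚ * ι (slopeTail v))
        ≡⟨ solve 2 (λ v s → con (+ 1 / 4) :* (con (ι (+ 4)) :* v) :+ :- (con (- 1ℚ) :* s) := v :+ s)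
             refl (ι (+ v)) (ι (slopeTail v)) ⟩
      ι (+ v) + ι (slopeTail v)
        ≡⟨ ι-slope v ⟨
      ι (slope alternatingWeight v) ∎

  ρ̃≡2*slope : ∀ v → ρ̃ v ≡ ι (+ 2 ℤ.* slope alternatingWeight v)
  ρ̃≡2*slope v = begin
    ι (+ (2 ℕ.* v)) - ∑₁ v (λ j → ι (+ e j (2 ℕ.* v)) * derivative (- 1ℚ) (ỹ (v ∸ j)))
      ≡⟨ cong₂ _-_ (trans (cong ι (ℤ.pos-* 2 v)) (ι-* (+ 2) (+ v)))
           (trans (∑<-cong v (λ k _ → double k))
             (trans (∑<-*ˡ v (ι (+ 2))
                 (λ k → ι (+ halfE (suc k) v) * derivative (- 1ℚ) (ỹ (v ∸ suc k))))
               (cong (ι (+ 2) *_) (ỹ-tail v (λ u _ → ỹ-derivative u))))) ⟩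
    ι (+ 2) * ι (+ v) - ι (+ 2) * (- 1ℚ * ι (slopeTail v))
      ≡⟨ solve 3 (λ c v s → c :* v :- c :* (con (- 1ℚ) :* s) := c :* (v :+ s))
           refl (ι (+ 2)) (ι (+ v)) (ι (slopeTail v)) ⟩
    ι (+ 2) * (ι (+ v) + ι (slopeTail v))
      ≡⟨ cong (ι (+ 2) *_) (ι-slope v) ⟨
    ι (+ 2) * ι (slope alternatingWeight v)
      ≡⟨ ι-* (+ 2) (slope alternatingWeight v) ⟨
    ι (+ 2 ℤ.* slope alternatingWeight v) ∎
    where
    double : ∀ k → ι (+ e (suc k) (2 ℕ.* v)) * derivative (- 1ℚ) (ỹ (v ∸ suc k))
      ≡ ι (+ 2) * (ι (+ halfE (suc k) v) * derivative (- 1ℚ) (ỹ (v ∸ suc k)))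
    double k = trans (cong (_* derivative (- 1ℚ) (ỹ (v ∸ suc k)))
        (trans (cong ι (trans (cong +_ (sym (2*halfE k v))) (ℤ.pos-* 2 (halfE (suc k) v))))
          (ι-* (+ 2) (+ halfE (suc k) v))))
      (*-assoc (ι (+ 2)) (ι (+ halfE (suc k) v)) _)

-- Parity of the value at 1, and the congruences for powers of 2.

module Conclusion where
  open import Data.Integer.Base as ℤ using (ℤ; +_; _+_; _*_; 1ℤ; -1ℤ)
  open import Data.Integer.Properties
  open import Data.Nat.Base as ℕ using (ℕ; suc; _∸_)
  import Data.Nat.Properties as ℕ
  open import Data.Product.Base using (_,_; _×_)
  open import Relation.Binary.PropositionalEquality
  open ≡-Reasoning
  open IntegerSums
  open LinearRecurrence
  open OddMoments

  -- The inhomogeneous term is 1^v = 1, and every weight e_j is even.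
  odd-power : ∀ v → Odd (power weight 1ℤ v)
  odd-power v = half , (begin
    power weight 1ℤ v
      ≡⟨ solution-rec weight (1ℤ ℤ.^_) v ⟩
    1ℤ ℤ.^ v + ∑ℤ.∑₁ v (λ j → weight j v * power weight 1ℤ (v ∸ j))
      ≡⟨ cong₂ _+_ (^-zeroˡ v) (∑<-cong v (λ i _ → term i)) ⟩
    1ℤ + ∑ℤ.∑₁ v (λ j → + 2 * (+ halfE j v * power weight 1ℤ (v ∸ j)))
      ≡⟨ cong (_+_ 1ℤ) (∑<-*ˡ v (+ 2) (λ i → + halfE (suc i) v * power weight 1ℤ (v ∸ suc i))) ⟩
    1ℤ + + 2 * half
      ≡⟨ +-comm 1ℤ (+ 2 * half) ⟩
    + 2 * half + 1ℤ ∎)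
    where
    half = ∑ℤ.∑₁ v (λ j → + halfE j v * power weight 1ℤ (v ∸ j))
    term : ∀ i → weight (suc i) v * power weight 1ℤ (v ∸ suc i)
      ≡ + 2 * (+ halfE (suc i) v * power weight 1ℤ (v ∸ suc i))
    term i = trans
      (cong (_* power weight 1ℤ (v ∸ suc i))
        (trans (cong +_ (sym (2*halfE i v))) (pos-* 2 (halfE (suc i) v))))
      (*-assoc (+ 2) (+ halfE (suc i) v) (power weight 1ℤ (v ∸ suc i)))

  -- The preceding results speak of n = suc m to have D (n - 1) without subtraction; this only
  -- transports them to n = 2^(a+1). The exponent is a successor because n / 2 has to be a power of
  -- 2 too.
  congruences : ∀ v a → let n = 2 ℕ.^ suc a in
      (∑ℤ.∑< n (λ k → + ((2 ℕ.* k ℕ.+ 1) ℕ.^ (2 ℕ.* v ℕ.+ 1) ℕ.* D k))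
        ≡ power weight 1ℤ v * + n [mod n ℕ.^ 3 ])
    × (∑ℤ.∑< n (λ k → -1ℤ ℤ.^ k * + ((2 ℕ.* k ℕ.+ 1) ℕ.^ (2 ℕ.* v ℕ.+ 1) ℕ.* D k))
        ≡ + 2 * slope alternatingWeight v * + (n ℕ.^ 2) [mod n ℕ.^ 3 ])
  congruences v a = subst
    (λ n →
        (∑ℤ.∑< n (λ k → + ((2 ℕ.* k ℕ.+ 1) ℕ.^ (2 ℕ.* v ℕ.+ 1) ℕ.* D k))
          ≡ power weight 1ℤ v * + n [mod n ℕ.^ 3 ])
      × (∑ℤ.∑< n (λ k → -1ℤ ℤ.^ k * + ((2 ℕ.* k ℕ.+ 1) ℕ.^ (2 ℕ.* v ℕ.+ 1) ℕ.* D k))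
          ≡ + 2 * slope alternatingWeight v * + (n ℕ.^ 2) [mod n ℕ.^ 3 ]))
    1+m≡n
    (moment-congruence v a m 1+m≡n , alternating-moment-congruence v a m 1+m≡n)
    where
    m = ℕ.pred (2 ℕ.^ suc a)
    1+m≡n : suc m ≡ 2 ℕ.^ suc a
    1+m≡n = ℕ.suc-pred (2 ℕ.^ suc a) ⦃ ℕ.m^n≢0 2 (suc a) ⦄

open import Data.Integer.Base as ℤ using (+_; -1ℤ)
open import Data.Nat.Base using (ℕ; suc; _≤_; _+_; _*_; _^_)
open import Data.Product.Base using (_×_; _,_; ∃-syntax)
open import Data.Rational.Base using (_/_)
open import Relation.Binary.PropositionalEquality using (_≡_; refl)
open LinearRecurrence using (power; slope)
open OddMoments using (weight; alternatingWeight)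

theorem1p3 : (v : ℕ) →
    ∃[ r ] ∃[ r̃ ]
    ρ v ≡ r / 1 × Odd r
    × ρ̃ v ≡ r̃ / 1 × Even r̃
    × ((a : ℕ) → 1 ≤ a → let n = 2 ^ a in
    (∑ℤ.∑< n (λ k → + ((2 * k + 1) ^ (2 * v + 1) * D k))
    ≡ r ℤ.* + n [mod n ^ 3 ])
    × (∑ℤ.∑< n (λ k → -1ℤ ℤ.^ k ℤ.* + ((2 * k + 1) ^ (2 * v + 1) * D k))
    ≡ r̃ ℤ.* + (n ^ 2) [mod n ^ 3 ]))
theorem1p3 v =
  power weight ℤ.1ℤ v , + 2 ℤ.* slope alternatingWeight v ,
  RationalPolynomials.ρ≡power v , Conclusion.odd-power v ,
  RationalPolynomials.ρ̃≡2*slope v , (slope alternatingWeight v , refl) ,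
  λ where (suc a) _ → Conclusion.congruences v a
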